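{- Let $G$ be a connected graph of order $m\geq 2$ and $H$ be a connected graph of order $n$. If $p(G)=\frac{n_o(G)}{2}$, then $p(G\Box H)\leq \frac{mn}{2}$.
   Context: All graphs are finite, simple and undirected. A path decomposition of a graph $G$ is a collection of edge-disjoint paths covering all edges of $G$; $p(G)$ denotes the minimum number of paths in a path decomposition of $G$. $n_o(G)$ denotes the number of vertices of odd degree in $G$. The Cartesian product $G\Box H$ has vertex set $V(G)\times V(H)$, with $(u_1,v_1)(u_2,v_2)$ an edge iff either $u_1u_2\in E(G)$ and $v_1=v_2$, or $v_1v_2\in E(H)$ and $u_1=u_2$. -}

module Defs where

open import Data.Nat using (ℕ; zero; suc; _+_; _*_; _≤_; _%_; _≡ᵇ_)
open import Data.Bool using (Bool; true; false; _∧_; _∨_; T)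
open import Data.Fin using (Fin; remQuot; _≟_)
open import Data.List using (List; []; _∷_; length; map; zip; filterᵇ; allFin)
open import Data.Nat.ListAction using (sum)
open import Data.List.Relation.Unary.All using (All)
open import Data.List.Relation.Unary.AllPairs using (AllPairs)
open import Data.Product using (_×_; _,_; Σ; ∃)
open import Relation.Nullary.Decidable using (⌊_⌋)
open import Relation.Binary.PropositionalEquality using (_≡_; _≢_)

Adj : ℕ → Set
Adj n = Fin n → Fin n → Bool

record IsSimple {n : ℕ} (A : Adj n) : Set where
  field
    symm   : ∀ u v → A u v ≡ A v u
    irrefl : ∀ u → A u u ≡ false

data Reach {n : ℕ} (A : Adj n) : Fin n → Fin n → Set where
  here : ∀ {u} → Reach A u u
  step : ∀ {u w v} → A u w ≡ true → Reach A w v → Reach A u v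

Connected : {n : ℕ} → Adj n → Set
Connected {n} A = ∀ (u v : Fin n) → Reach A u v

degree : {n : ℕ} → Adj n → Fin n → ℕ
degree A u = length (filterᵇ (A u) (allFin _))

isOdd : ℕ → Bool
isOdd k = (k % 2) ≡ᵇ 1

nOdd : {n : ℕ} → Adj n → ℕ
nOdd A = length (filterᵇ (λ u → isOdd (degree A u)) (allFin _))

steps : {n : ℕ} → List (Fin n) → List (Fin n × Fin n)
steps []       = []
steps (x ∷ xs) = zip (x ∷ xs) xs

record IsPath {n : ℕ} (A : Adj n) (P : List (Fin n)) : Set where
  field
    nontrivial : 2 ≤ length P
    distinct   : AllPairs _≢_ P
    adjacent   : All (λ e → A (Data.Product.proj₁ e) (Data.Product.proj₂ e) ≡ true) (steps P)

traverses : {n : ℕ} → Fin n → Fin n → Fin n × Fin n → Bool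
traverses u v (x , y) = (⌊ x ≟ u ⌋ ∧ ⌊ y ≟ v ⌋) ∨ (⌊ x ≟ v ⌋ ∧ ⌊ y ≟ u ⌋)

edgeUses : {n : ℕ} → Fin n → Fin n → List (List (Fin n)) → ℕ
edgeUses u v D = sum (map (λ P → length (filterᵇ (traverses u v) (steps P))) D)

record IsPathDecomposition {n : ℕ} (A : Adj n) (D : List (List (Fin n))) : Set where
  field
    paths : All (IsPath A) D
    exact : ∀ u v → A u v ≡ true → edgeUses u v D ≡ 1

IsPathNumber : {n : ℕ} → Adj n → ℕ → Set
IsPathNumber A k =
  Σ (List (List _)) (λ D → IsPathDecomposition A D × length D ≡ k)
  × (∀ D → IsPathDecomposition A D → k ≤ length D)

-- Cartesian product G □ H on Fin (m * n); vertex combine i j ↔ (i , j)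
_□_ : {m n : ℕ} → Adj m → Adj n → Adj (m * n)
_□_ {m} {n} G H x y with remQuot {m} n x | remQuot {m} n y
... | (a , b) | (c , d) = (G a c ∧ ⌊ b ≟ d ⌋) ∨ (⌊ a ≟ c ⌋ ∧ H b d)

{-# OPTIONS --safe #-}
module Submission where

-- By parity the path decomposition of G ends exactly once at each odd vertex and never at an
-- even one.  Lovász's argument decomposes H into paths, trivial ones allowed, such that each
-- vertex is an end once or twice, according to parity; these paths can be directed so that
-- each vertex is the start of at most one and the finish of at most one.  Now follow the n
-- copies of each path of G, inserting paths of H in the copies of H: both end layers of the
-- path, and for each even vertex of G the layer met on one chosen path through it.  In an end
-- layer the paths of H are absorbed at no cost; in an inner layer the number of paths grows
-- by the number of vertices where no path of H starts, at most n / 2.  So every vertex of G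
-- accounts for at most n / 2 paths.

open import Defs
open import Data.Bool using (Bool; true; false; _∧_; _∨_; if_then_else_)
open import Data.Empty using (⊥-elim)
open import Data.Fin using (Fin; zero; suc; _≟_; _<?_; combine; remQuot)
open import Data.Fin.Properties using (<-cmp; combine-injective; combine-remQuot; remQuot-combine)
open import Data.List
  using (List; []; _∷_; _++_; _ʳ++_; length; map; filter; filterᵇ; tabulate; allFin; cartesianProduct)
open import Data.List.Properties
  using (map-++; map-∘; map-id; map-tabulate; length-map; length-++; length-tabulate; filter-notAll; ∷-injectiveˡ; ∷-injectiveʳ)
open import Data.List.Membership.Propositional using (_∈_; _∉_; lose)
open import Data.List.Membership.Propositional.Properties
  using (∈-∃++; ∈-allFin; ∈-filter⁺; ∈-filter⁻; ∈-++⁺ˡ; ∈-++⁻; ∈-map⁻)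
open import Data.List.Relation.Binary.Permutation.Propositional
  using (_↭_; ↭-refl; ↭-reflexive; ↭-sym; ↭-trans; prep)
open import Data.List.Relation.Binary.Permutation.Propositional.Properties
  using (map⁺; shift; ++⁺ˡ; All-resp-↭; ∈-resp-↭; ↭-length; ↭-map-inv)
open import Data.List.Relation.Unary.All as All using (All; []; _∷_)
import Data.List.Relation.Unary.All.Properties as Allₚ
open import Data.List.Relation.Unary.AllPairs using (AllPairs; []; _∷_)
open import Data.List.Relation.Unary.Any using (here; there)
open import Data.Nat using (ℕ; zero; suc; _+_; _*_; _≤_; z≤n; s≤s; _≡ᵇ_)
open import Data.Nat.DivMod using (m*n%n≡0)
open import Data.Nat.ListAction using (sum)
open import Data.Nat.ListAction.Properties using (sum-++; sum-↭)
open import Data.Nat.Properties hiding (_≟_; <-cmp; _<?_)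
open import Data.Nat.Tactic.RingSolver using (solve-∀)
open import Data.Product using (Σ; ∃; _×_; _,_; proj₁; proj₂)
open import Data.Sum using (_⊎_; inj₁; inj₂)
open import Function using (_∘_; id)
open import Relation.Binary using (tri<; tri≈; tri>)
open import Relation.Binary.PropositionalEquality
  using (_≡_; _≢_; refl; sym; trans; cong; cong₂; subst; subst₂; module ≡-Reasoning)
open import Relation.Nullary using (¬_; ¬?; yes; no; does)
open import Relation.Nullary.Decidable using (⌊_⌋; dec-true; dec-false)

-- Both bounds on the ends in H are used. At most two ends per vertex makes the directions possible:
-- with the paths of H taken as edges between their ends, all degrees are at most 2, so the
-- components are paths and cycles, and each is directed along itself. At least one end per vertex
-- forces at least `n / 2` paths, which leaves at most `n / 2` vertices where none starts. The
-- obstacle in an inserted layer is that `n` paths must leave it, one from each vertex, or copies of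
-- the next edge of G would be missed. Pairing the vertices where no path of H starts with those
-- where none finishes repairs this: the layer then acts as a permutation of the vertices of H. The
-- `n` copies of a path of G are `n` paths before any inner layer is inserted, which is `n / 2` for
-- each of its two ends. So an odd vertex pays as an end and an even one as an inner layer, and the
-- shares agree.

private variable
  A B : Set
  m n : ℕ

-- Finite sums and indicators

⟦_⟧ : Bool → ℕ
⟦ b ⟧ = if b then 1 else 0

∑ : (A → ℕ) → List A → ℕ
∑ f xs = sum (map f xs)

∑-++ : ∀ (f : A → ℕ) xs ys → ∑ f (xs ++ ys) ≡ ∑ f xs + ∑ f ys
∑-++ f xs ys = trans (cong sum (map-++ f xs ys)) (sum-++ (map f xs) (map f ys))

∑-↭ : ∀ (f : A → ℕ) {xs ys} → xs ↭ ys → ∑ f xs ≡ ∑ f ys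
∑-↭ f p = sum-↭ (map⁺ f p)

∑-cong-All : ∀ {f g : A → ℕ} {xs} → All (λ x → f x ≡ g x) xs → ∑ f xs ≡ ∑ g xs
∑-cong-All []       = refl
∑-cong-All (p ∷ ps) = cong₂ _+_ p (∑-cong-All ps)

∑-cong : ∀ {f g : A → ℕ} → (∀ x → f x ≡ g x) → ∀ xs → ∑ f xs ≡ ∑ g xs
∑-cong h []       = refl
∑-cong h (x ∷ xs) = cong₂ _+_ (h x) (∑-cong h xs)

+-interchange : ∀ a b c d → (a + b) + (c + d) ≡ (a + c) + (b + d)
+-interchange = solve-∀

∑-+ : ∀ (f g : A → ℕ) xs → ∑ (λ x → f x + g x) xs ≡ ∑ f xs + ∑ g xs
∑-+ f g []       = refl
∑-+ f g (x ∷ xs) = trans (cong (f x + g x +_) (∑-+ f g xs)) (+-interchange (f x) (g x) _ _)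

∑-*ˡ : ∀ c (f : A → ℕ) xs → ∑ (λ x → c * f x) xs ≡ c * ∑ f xs
∑-*ˡ c f []       = sym (*-zeroʳ c)
∑-*ˡ c f (x ∷ xs) = trans (cong (c * f x +_) (∑-*ˡ c f xs)) (sym (*-distribˡ-+ c (f x) _))

∑-0 : ∀ {f : A → ℕ} → (∀ x → f x ≡ 0) → ∀ xs → ∑ f xs ≡ 0
∑-0 h []       = refl
∑-0 h (x ∷ xs) = cong₂ _+_ (h x) (∑-0 h xs)

∑-1 : ∀ (xs : List A) → ∑ (λ _ → 1) xs ≡ length xs
∑-1 []       = refl
∑-1 (x ∷ xs) = cong suc (∑-1 xs)

∑-swap : ∀ (f : A → B → ℕ) xs ys →
  ∑ (λ x → ∑ (f x) ys) xs ≡ ∑ (λ y → ∑ (λ x → f x y) xs) ys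
∑-swap f []       ys = sym (∑-0 (λ _ → refl) ys)
∑-swap f (x ∷ xs) ys =
  trans (cong (∑ (f x) ys +_) (∑-swap f xs ys)) (sym (∑-+ (f x) _ ys))

∑-map : ∀ (f : B → ℕ) (g : A → B) xs → ∑ f (map g xs) ≡ ∑ (f ∘ g) xs
∑-map f g []       = refl
∑-map f g (x ∷ xs) = cong (f (g x) +_) (∑-map f g xs)

∑-mono : ∀ {f g : A → ℕ} → (∀ x → f x ≤ g x) → ∀ xs → ∑ f xs ≤ ∑ g xs
∑-mono h []       = z≤n
∑-mono h (x ∷ xs) = +-mono-≤ (h x) (∑-mono h xs)

∈⇒≤∑ : ∀ (f : A → ℕ) {x xs} → x ∈ xs → f x ≤ ∑ f xs
∈⇒≤∑ f (here refl) = m≤m+n _ _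
∈⇒≤∑ f (there p)   = ≤-trans (∈⇒≤∑ f p) (m≤n+m _ _)

∑-positive : ∀ (f : A → ℕ) xs → 1 ≤ ∑ f xs → ∃ λ x → x ∈ xs × 1 ≤ f x
∑-positive f (x ∷ xs) p with f x in eq
... | suc _ = x , here refl , subst (1 ≤_) (sym eq) (s≤s z≤n)
... | zero with ∑-positive f xs p
...   | y , y∈ , q = y , there y∈ , q

∈⇒↭ : ∀ {x : A} {xs} → x ∈ xs → ∃ λ ys → xs ↭ x ∷ ys
∈⇒↭ x∈ with ∈-∃++ x∈
... | ys , zs , refl = ys ++ zs , shift _ ys zs

-- A strict inequality at one entry could not be made up elsewhere. Applied to odd degrees against
-- path ends, this turns the number of paths of `G` into a statement at each vertex.
∑-≡⇒pointwise : ∀ {f g : A → ℕ} → (∀ x → f x ≤ g x) → ∀ xs → ∑ f xs ≡ ∑ g xs →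
  ∀ {x} → x ∈ xs → f x ≡ g x
∑-≡⇒pointwise {f = f} {g} h (y ∷ xs) eq = λ where
    (here refl) → ≤-antisym (h y) (+-cancelʳ-≤ (∑ f xs) (g y) (f y)
      (≤-trans (+-monoʳ-≤ (g y) (∑-mono h xs)) (≤-reflexive (sym eq))))
    (there x∈)  → ∑-≡⇒pointwise h xs (≤-antisym (∑-mono h xs)
      (+-cancelˡ-≤ (f y) _ _ (≤-trans (+-monoˡ-≤ _ (h y)) (≤-reflexive (sym eq))))) x∈

δ : Fin n → Fin n → ℕ
δ x y = ⟦ does (x ≟ y) ⟧

δ-refl : ∀ (x : Fin n) → δ x x ≡ 1
δ-refl x = cong ⟦_⟧ (dec-true (x ≟ x) refl)

δ-≢ : ∀ {x y : Fin n} → x ≢ y → δ x y ≡ 0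
δ-≢ {x = x} {y} ne = cong ⟦_⟧ (dec-false (x ≟ y) ne)

δ-sym : ∀ (x y : Fin n) → δ x y ≡ δ y x
δ-sym x y with x ≟ y
... | yes refl = sym (δ-refl x)
... | no ne    = sym (δ-≢ (ne ∘ sym))

δ-positive : ∀ (x y : Fin n) → 1 ≤ δ x y → x ≡ y
δ-positive x y p with x ≟ y
... | yes e = e

δ-≤1 : ∀ (x y : Fin n) → δ x y ≤ 1
δ-≤1 x y with x ≟ y
... | yes _ = ≤-refl
... | no _  = z≤n

∑δ : ∀ (v : Fin n) (f : Fin n → ℕ) → ∑ (λ u → δ v u * f u) (allFin n) ≡ f v
∑δ {suc n} v f = trans (cong (δ v zero * f zero +_) (tail v)) (split v)
  where
  tail : ∀ v → ∑ (λ u → δ v u * f u) (tabulate suc) ≡ ∑ (λ u → δ v (suc u) * f (suc u)) (allFin n)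
  tail v = trans (cong (∑ (λ u → δ v u * f u)) (sym (map-tabulate id suc)))
                 (∑-map (λ u → δ v u * f u) suc (allFin n))
  split : ∀ v → δ v zero * f zero + ∑ (λ u → δ v (suc u) * f (suc u)) (allFin n) ≡ f v
  split zero    = trans (cong₂ _+_ (*-identityˡ (f zero)) (∑-0 (λ _ → refl) (allFin n))) (+-identityʳ _)
  split (suc v) = ∑δ v (f ∘ suc)

∑δ-one : ∀ (v : Fin n) → ∑ (δ v) (allFin n) ≡ 1
∑δ-one {n} v = trans (∑-cong (λ u → sym (*-identityʳ (δ v u))) (allFin n)) (∑δ v (λ _ → 1))

-- Paths as lists of vertices

occ : Fin n → List (Fin n) → ℕ
occ z P = ∑ (δ z) P

-- Occurrence counts add up under reversal and gluing, so simplicity of a rearranged path is plain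
-- arithmetic.
Simple : List (Fin n) → Set
Simple P = ∀ z → occ z P ≤ 1

last : A → List A → A
last a []       = a
last a (b ∷ bs) = last b bs

-- A one-vertex path has two ends at its vertex.
ends : Fin n → List (Fin n) → ℕ
ends z []       = 0
ends z (a ∷ as) = δ z a + δ z (last a as)

-- For x ≢ y this is the indicator of {u , v} = {x , y}; unlike traverses it is a polynomial in δ.
edge : Fin n → Fin n → Fin n → Fin n → ℕ
edge u v x y = δ x u * δ y v + δ x v * δ y u

walk : Fin n → Fin n → Fin n → List (Fin n) → ℕ
walk u v a []       = 0
walk u v a (b ∷ bs) = edge u v a b + walk u v b bs

uses : Fin n → Fin n → List (Fin n) → ℕ
uses u v []       = 0
uses u v (a ∷ as) = walk u v a as

edge-comm : ∀ (u v x y : Fin n) → edge u v x y ≡ edge u v y x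
edge-comm u v x y = lemma (δ x u) (δ y v) (δ x v) (δ y u)
  where
  lemma : ∀ a b c d → a * b + c * d ≡ d * c + b * a
  lemma = solve-∀

edge-self : ∀ (x y : Fin n) → 1 ≤ edge x y x y
edge-self x y rewrite δ-refl x | δ-refl y = s≤s z≤n

last-ʳ++ : ∀ (as : List A) a ys → ∃ λ cs →
  as ʳ++ (a ∷ ys) ≡ last a as ∷ cs × last (last a as) cs ≡ last a ys
last-ʳ++ []       a ys = ys , refl , refl
last-ʳ++ (b ∷ bs) a ys = last-ʳ++ bs b (a ∷ ys)

uses-ʳ++ : ∀ (u v a : Fin n) as ys → uses u v (as ʳ++ (a ∷ ys)) ≡ walk u v a as + walk u v a ys
uses-ʳ++ u v a []       ys = refl
uses-ʳ++ u v a (b ∷ bs) ys = trans (uses-ʳ++ u v b bs (a ∷ ys))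
  (trans (cong (λ e → walk u v b bs + (e + walk u v a ys)) (edge-comm u v b a))
         (lemma (walk u v b bs) (edge u v a b) (walk u v a ys)))
  where
  lemma : ∀ x y z → x + (y + z) ≡ (y + x) + z
  lemma = solve-∀

ends-ʳ++ : ∀ (z a : Fin n) as ys → ends z (as ʳ++ (a ∷ ys)) ≡ δ z (last a as) + δ z (last a ys)
ends-ʳ++ z a as ys with last-ʳ++ as a ys
... | cs , eq , eq′ rewrite eq | eq′ = refl

∑-ʳ++ : ∀ (f : A → ℕ) as ys → ∑ f (as ʳ++ ys) ≡ ∑ f as + ∑ f ys
∑-ʳ++ f []       ys = refl
∑-ʳ++ f (a ∷ as) ys = trans (∑-ʳ++ f as (a ∷ ys)) (lemma (∑ f as) (f a) (∑ f ys))
  where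
  lemma : ∀ x y z → x + (y + z) ≡ (y + x) + z
  lemma = solve-∀

+-positive : ∀ a b → 1 ≤ a + b → 1 ≤ a ⊎ 1 ≤ b
+-positive zero    b p = inj₂ p
+-positive (suc a) b p = inj₁ (s≤s z≤n)

-- Holds between a path and its reversal.
record _≈_ (P Q : List (Fin n)) : Set where
  field
    occ-≈  : ∀ z → occ z P ≡ occ z Q
    uses-≈ : ∀ u v → uses u v P ≡ uses u v Q
    ends-≈ : ∀ z → ends z P ≡ ends z Q
open _≈_ public

reverse-≈ : ∀ (a : Fin n) as → ∃ λ bs → last (last a as) bs ≡ a × (last a as ∷ bs) ≈ (a ∷ as)
reverse-≈ a as with last-ʳ++ as a []
... | bs , eq , eq′ = bs , eq′ , record
  { occ-≈  = λ z → trans (cong (occ z) (sym eq)) (trans (∑-ʳ++ (δ z) as (a ∷ [])) (lemma (occ z as) (δ z a)))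
  ; uses-≈ = λ u v → trans (cong (uses u v) (sym eq)) (trans (uses-ʳ++ u v a as []) (+-identityʳ _))
  ; ends-≈ = λ z → trans (cong (λ e → δ z (last a as) + δ z e) eq′) (+-comm (δ z (last a as)) (δ z a))
  }
  where
  lemma : ∀ x y → x + (y + 0) ≡ y + x
  lemma = solve-∀

start-at : ∀ (z : Fin n) P → 1 ≤ ends z P → ∃ λ bs → (z ∷ bs) ≈ P
start-at z (a ∷ as) p with +-positive (δ z a) _ p
... | inj₁ q with refl ← δ-positive z a q = as , record
        { occ-≈ = λ _ → refl ; uses-≈ = λ _ _ → refl ; ends-≈ = λ _ → refl }
... | inj₂ q with refl ← δ-positive z (last a as) q with reverse-≈ a as
...   | bs , _ , same = bs , same

-- Inserting an edge into a family of paths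

-- The last equation trades a path end at `c` for one at `x`; `δ z c` stands on the left to avoid
-- truncated subtraction.
Inserted : Fin n → Fin n → List (List (Fin n)) → Set
Inserted {n} x c D = Σ (List (List (Fin n))) λ D′ → All Simple D′
  × (∀ u v → ∑ (uses u v) D′ ≡ ∑ (uses u v) D + edge u v x c)
  × (∀ z → ∑ (ends z) D′ + δ z c ≡ ∑ (ends z) D + δ z x)

Inserted-resp-↭ : ∀ {x c : Fin n} {D D₁} → D ↭ D₁ → Inserted x c D₁ → Inserted x c D
Inserted-resp-↭ {x = x} {c} p (D′ , s , u , e) = D′ , s
  , (λ a b → trans (u a b) (cong (_+ edge a b x c) (sym (∑-↭ (uses a b) p))))
  , (λ z → trans (e z) (cong (_+ δ z x) (sym (∑-↭ (ends z) p))))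

-- Inserting the edge x c into a path family, at the cost of one path end at c.  A path through
-- the centre x is a pair of arms read from x outwards.  If c is the end of an arm with first
-- vertex w, reversing that arm covers x c and uncovers x w; the pending edge then moves on to
-- an arm ending in w.  No arm is reversed twice, as S holds the first vertices of the arms
-- which may still be reversed.
module Fan (x : Fin n) where

  Arms : Set
  Arms = List (Fin n) × List (Fin n)

  glue : Arms → List (Fin n)
  glue (A , B) = A ʳ++ (x ∷ B)

  occ-glue : ∀ z A B → occ z (glue (A , B)) ≡ δ z x + (occ z A + occ z B)
  occ-glue z A B = trans (∑-ʳ++ (δ z) A (x ∷ B)) (lemma (occ z A) (δ z x) (occ z B))
    where
    lemma : ∀ a b c → a + (b + c) ≡ b + (a + c)
    lemma = solve-∀

  glue-swap : ∀ A B → glue (A , B) ≈ glue (B , A)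
  glue-swap A B = record
    { occ-≈  = λ z → trans (occ-glue z A B)
        (trans (cong (δ z x +_) (+-comm (occ z A) (occ z B))) (sym (occ-glue z B A)))
    ; uses-≈ = λ u v → trans (uses-ʳ++ u v x A B) (trans (+-comm (walk u v x A) _) (sym (uses-ʳ++ u v x B A)))
    ; ends-≈ = λ z → trans (ends-ʳ++ z x A B) (trans (+-comm (δ z (last x A)) _) (sym (ends-ʳ++ z x B A)))
    }

  split : ∀ P → occ x P ≡ 0 ⊎ ∃ λ p → P ≡ glue p
  split P = go P []
    where
    go : ∀ P A → occ x P ≡ 0 ⊎ ∃ λ p → A ʳ++ P ≡ glue p
    go []       A = inj₁ refl
    go (a ∷ P) A with x ≟ a
    ... | yes refl = inj₂ ((A , P) , refl)
    ... | no x≢a with go P (a ∷ A)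
    ...   | inj₁ e = inj₁ e
    ...   | inj₂ e = inj₂ e

  family : List (List (Fin n)) → List Arms → List (List (Fin n))
  family free thru = free ++ map glue thru

  partition : ∀ D → ∃ λ free → ∃ λ thru → D ↭ family free thru × All (λ P → occ x P ≡ 0) free
  partition []       = [] , [] , ↭-refl , []
  partition (P ∷ D) with partition D | split P
  ... | free , thru , p , o | inj₁ e = P ∷ free , thru , prep P p , e ∷ o
  ... | free , thru , p , o | inj₂ (q , refl) =
        free , q ∷ thru , ↭-trans (prep P p) (↭-sym (shift P free (map glue thru))) , o

  head# : Fin n → List (Fin n) → ℕ
  head# w []      = 0
  head# w (a ∷ _) = δ w a

  heads : Fin n → List Arms → ℕ
  heads w = ∑ λ (A , B) → head# w A + head# w B

  -- The empty arm is excluded: it ends at the centre and has no first edge to give up.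
  ArmTo : Fin n → List (Fin n) → List (Fin n) → Set
  ArmTo z S A = ∃ λ a → ∃ λ as → A ≡ a ∷ as × last a as ≡ z × a ∈ S

  ArmsTo : Fin n → List (Fin n) → Arms → Set
  ArmsTo z S (A , B) = ArmTo z S A ⊎ ArmTo z S B

  Supplied : List (Fin n) → List (List (Fin n)) → List Arms → Fin n → Set
  Supplied S free thru z = (∃ λ P → P ∈ free × 1 ≤ ends z P) ⊎ (∃ λ p → p ∈ thru × ArmsTo z S p)

  ArmsTo-swap : ∀ {z S} A B → ArmsTo z S (A , B) → ArmsTo z S (B , A)
  ArmsTo-swap A B (inj₁ p) = inj₂ p
  ArmsTo-swap A B (inj₂ p) = inj₁ p

  attach : ∀ {c P D} → P ∈ D → occ x P ≡ 0 → 1 ≤ ends c P → All Simple D → Inserted x c D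
  attach {c} {P} {D} P∈ x∉P cP sD with ∈⇒↭ P∈ | start-at c P cP
  ... | D″ , p | bs , same = (x ∷ c ∷ bs) ∷ D″ , simple (All-resp-↭ p sD) , uses-eq , ends-eq
    where
    simple : All Simple (P ∷ D″) → All Simple ((x ∷ c ∷ bs) ∷ D″)
    simple (sP ∷ s) = (λ z → ≤-trans (+-monoʳ-≤ (δ z x) (≤-reflexive (occ-≈ same z))) (bound z)) ∷ s
      where
      bound : ∀ z → δ z x + occ z P ≤ 1
      bound z with z ≟ x
      ... | yes refl = s≤s (≤-reflexive x∉P)
      ... | no _     = sP z
    uses-eq : ∀ u v → ∑ (uses u v) ((x ∷ c ∷ bs) ∷ D″) ≡ ∑ (uses u v) D + edge u v x c
    uses-eq u v = trans (cong (λ e → edge u v x c + e + ∑ (uses u v) D″) (uses-≈ same u v))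
      (trans (lemma (edge u v x c) (uses u v P) _) (cong (_+ edge u v x c) (sym (∑-↭ (uses u v) p))))
      where
      lemma : ∀ a b c → (a + b) + c ≡ (b + c) + a
      lemma = solve-∀
    ends-eq : ∀ z → ∑ (ends z) ((x ∷ c ∷ bs) ∷ D″) + δ z c ≡ ∑ (ends z) D + δ z x
    ends-eq z = trans (lemma (δ z x) (δ z (last c bs)) (∑ (ends z) D″) (δ z c))
      (cong (_+ δ z x) (trans (cong (_+ ∑ (ends z) D″) (ends-≈ same z)) (sym (∑-↭ (ends z) p))))
      where
      lemma : ∀ a b c d → ((a + b) + c) + d ≡ ((d + b) + c) + a
      lemma = solve-∀

  ArmTo-mono : ∀ {z S S′ A} → (∀ {a as} → A ≡ a ∷ as → a ∈ S → a ∈ S′) → ArmTo z S A → ArmTo z S′ A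
  ArmTo-mono h (a , as , e , l , a∈) = a , as , e , l , h e a∈

  _-_ : List (Fin n) → Fin n → List (Fin n)
  S - w = filter (λ z → ¬? (z ≟ w)) S

  ∈-minus : ∀ {S w a} → a ∈ S → a ≢ w → a ∈ (S - w)
  ∈-minus = ∈-filter⁺ (λ z → ¬? (z ≟ _))

  -- The invariants keep the reversals going: each vertex of `c ∷ S` has a usable path end, and a
  -- vertex of `S` is first on at most one arm, so striking `w` from `S` disables no arm but the
  -- reversed one. `k` bounds the reversals left.
  insert : ∀ k S c free thru → length S ≤ k → c ∉ S
    → (∀ {w} → w ∈ S → heads w thru ≤ 1)
    → (∀ {z} → z ∈ c ∷ S → Supplied S free thru z)
    → All (λ P → occ x P ≡ 0) free → All Simple (family free thru)
    → Inserted x c (family free thru)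
  reverse-arm : ∀ k S c free thru A B thru″ → length S ≤ k → c ∉ S
    → (∀ {w} → w ∈ S → heads w thru ≤ 1)
    → (∀ {z} → z ∈ c ∷ S → Supplied S free thru z)
    → All (λ P → occ x P ≡ 0) free → All Simple (family free thru)
    → thru ↭ (A , B) ∷ thru″ → ArmTo c S A
    → Inserted x c (family free thru)

  insert k S c free thru len c∉S hd sup x∉ sD with sup (here refl)
  ... | inj₁ (P , P∈ , cP) = attach (∈-++⁺ˡ P∈) (All.lookup x∉ P∈) cP sD
  ... | inj₂ ((A , B) , p∈ , inj₁ arm) with ∈⇒↭ p∈
  ...   | thru″ , p = reverse-arm k S c free thru A B thru″ len c∉S hd sup x∉ sD p arm
  insert k S c free thru len c∉S hd sup x∉ sD | inj₂ ((A , B) , p∈ , inj₂ arm) with ∈⇒↭ p∈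
  ... | thru″ , p = swapped (reverse-arm k S c free thru₁ B A thru″ len c∉S hd₁ sup₁ x∉ sD₁ ↭-refl arm)
    where
    thru₁ : List Arms
    thru₁ = (B , A) ∷ thru″
    q : family free thru ↭ glue (A , B) ∷ family free thru″
    q = ↭-trans (++⁺ˡ free (map⁺ glue p)) (shift _ free _)
    q₁ : family free thru₁ ↭ glue (B , A) ∷ family free thru″
    q₁ = shift _ free _
    hd₁ : ∀ {w} → w ∈ S → heads w thru₁ ≤ 1
    hd₁ {w} w∈ = ≤-trans (≤-reflexive (trans (cong (_+ heads w thru″) (+-comm (head# w B) (head# w A)))
                   (sym (∑-↭ (λ (A , B) → head# w A + head# w B) p)))) (hd w∈)
    sup₁ : ∀ {z} → z ∈ c ∷ S → Supplied S free thru₁ z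
    sup₁ z∈ with sup z∈
    ... | inj₁ w = inj₁ w
    ... | inj₂ (r , r∈ , w) with ∈-resp-↭ p r∈
    ...   | here refl = inj₂ ((B , A) , here refl , ArmsTo-swap A B w)
    ...   | there r∈′ = inj₂ (r , there r∈′ , w)
    sD₁ : All Simple (family free thru₁)
    sD₁ with All-resp-↭ q sD
    ... | s ∷ ss = All-resp-↭ (↭-sym q₁)
                     ((λ z → ≤-trans (≤-reflexive (occ-≈ (glue-swap B A) z)) (s z)) ∷ ss)
    swapped : Inserted x c (family free thru₁) → Inserted x c (family free thru)
    swapped (D′ , s , u , e) = D′ , s
      , (λ a b → trans (u a b) (cong (_+ edge a b x c) (trans (∑-↭ (uses a b) q₁)
          (trans (cong (_+ ∑ (uses a b) (family free thru″)) (uses-≈ (glue-swap B A) a b)) (sym (∑-↭ (uses a b) q))))))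
      , (λ z → trans (e z) (cong (_+ δ z x) (trans (∑-↭ (ends z) q₁)
          (trans (cong (_+ ∑ (ends z) (family free thru″)) (ends-≈ (glue-swap B A) z)) (sym (∑-↭ (ends z) q))))))

  reverse-arm zero    [] c free thru A B thru″ len c∉S hd sup x∉ sD p (w , as , refl , lst , ())
  reverse-arm (suc k) S c free thru A B thru″ len c∉S hd sup x∉ sD p (w , as , refl , refl , w∈S)
    with reverse-≈ w as
  ... | cs , lst , same = moved (insert k (S - w) w free thru₁ len₁ w∉ hd₁ sup₁ x∉ sD₁)
    where
    thru₁ : List Arms
    thru₁ = (c ∷ cs , B) ∷ thru″
    R : List (List (Fin n))
    R = family free thru″
    q : family free thru ↭ glue (w ∷ as , B) ∷ R
    q = ↭-trans (++⁺ˡ free (map⁺ glue p)) (shift _ free _)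
    q₁ : family free thru₁ ↭ glue (c ∷ cs , B) ∷ R
    q₁ = shift _ free _
    len₁ : length (S - w) ≤ k
    len₁ = ≤-pred (≤-trans (filter-notAll (λ z → ¬? (z ≟ w)) S (lose w∈S (λ ne → ne refl))) len)
    w∉ : w ∉ (S - w)
    w∉ w∈ = proj₂ (∈-filter⁻ (λ z → ¬? (z ≟ w)) {xs = S} w∈) refl
    old : ∀ {v} → v ∈ (S - w) → v ∈ S × v ≢ w
    old = ∈-filter⁻ (λ z → ¬? (z ≟ w))
    heads-split : ∀ v → heads v thru ≡ (δ v w + head# v B) + heads v thru″
    heads-split v = ∑-↭ (λ (A , B) → head# v A + head# v B) p
    hd₁ : ∀ {v} → v ∈ (S - w) → heads v thru₁ ≤ 1
    hd₁ {v} v∈ = ≤-trans (≤-reflexive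
      (trans (cong (λ e → (e + head# v B) + heads v thru″)
                (trans (δ-≢ {x = v} {c} λ { refl → c∉S (proj₁ (old v∈)) }) (sym (δ-≢ (proj₂ (old v∈))))))
             (sym (heads-split v)))) (hd (proj₁ (old v∈)))
    -- The reversed arm is already the only one allowed to start with `w`.
    heads-w : head# w B + heads w thru″ ≤ 0
    heads-w = ≤-pred (≤-trans (≤-reflexive (trans (cong (λ e → (e + head# w B) + heads w thru″) (sym (δ-refl w)))
                (sym (heads-split w)))) (hd w∈S))
    no-other : ∀ {a as′ A′} → A′ ≡ a ∷ as′ → head# w A′ ≤ 0 → a ≢ w
    no-other refl h refl = 1+n≰n (≤-trans (≤-reflexive (sym (δ-refl w))) h)
    shrink : ∀ {z A′} → head# w A′ ≤ 0 → ArmTo z S A′ → ArmTo z (S - w) A′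
    shrink h = ArmTo-mono (λ e a∈ → ∈-minus a∈ (no-other e h))
    kept : ∀ {z} A′ B′ → head# w A′ + head# w B′ ≤ 0 → ArmsTo z S (A′ , B′) → ArmsTo z (S - w) (A′ , B′)
    kept A′ B′ h (inj₁ t) = inj₁ (shrink (≤-trans (m≤m+n _ _) h) t)
    kept A′ B′ h (inj₂ t) = inj₂ (shrink (≤-trans (m≤n+m _ (head# w A′)) h) t)
    -- The reversed arm ended in `c`, so it supplied no vertex of `S`. The supplying arms are thus
    -- other ones, and their first vertices survive in `S - w`.
    sup-S : ∀ {z} → z ∈ S → Supplied (S - w) free thru₁ z
    sup-S z∈ with sup (there z∈)
    ... | inj₁ t = inj₁ t
    ... | inj₂ (r , r∈ , t) with ∈-resp-↭ p r∈
    ...   | there r∈′ = inj₂ (r , there r∈′ , kept (proj₁ r) (proj₂ r) (≤-trans (∈⇒≤∑ (λ (A , B) → head# w A + head# w B) r∈′)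
                          (≤-trans (m≤n+m _ _) heads-w)) t)
    ...   | here refl with t
    ...     | inj₁ (_ , _ , refl , refl , _) = ⊥-elim (c∉S z∈)
    ...     | inj₂ t′ = inj₂ (_ , here refl , inj₂ (shrink (≤-trans (m≤m+n _ _) heads-w) t′))
    sup₁ : ∀ {z} → z ∈ w ∷ (S - w) → Supplied (S - w) free thru₁ z
    sup₁ (here refl) = sup-S w∈S
    sup₁ (there z∈)  = sup-S (proj₁ (old z∈))
    occ-eq : ∀ z → occ z (glue (c ∷ cs , B)) ≡ occ z (glue (w ∷ as , B))
    occ-eq z = trans (occ-glue z (c ∷ cs) B) (trans (cong (λ e → δ z x + (e + occ z B)) (occ-≈ same z))
                 (sym (occ-glue z (w ∷ as) B)))
    sD₁ : All Simple (family free thru₁)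
    sD₁ with All-resp-↭ q sD
    ... | s ∷ ss = All-resp-↭ (↭-sym q₁) ((λ z → ≤-trans (≤-reflexive (occ-eq z)) (s z)) ∷ ss)
    uses₁ : ∀ u v → ∑ (uses u v) (family free thru₁) + edge u v x w
                  ≡ ∑ (uses u v) (family free thru) + edge u v x c
    uses₁ u v = trans (cong (_+ edge u v x w) (∑-↭ (uses u v) q₁)) (trans
      (trans (cong (λ e → e + ∑ (uses u v) R + edge u v x w)
               (trans (uses-ʳ++ u v x (c ∷ cs) B)
                 (cong (λ e → edge u v x c + e + walk u v x B) (uses-≈ same u v))))
        (trans (lemma (edge u v x c) (walk u v w as) (walk u v x B) (∑ (uses u v) R) (edge u v x w))
          (cong (λ e → e + ∑ (uses u v) R + edge u v x c) (sym (uses-ʳ++ u v x (w ∷ as) B)))))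
      (cong (_+ edge u v x c) (sym (∑-↭ (uses u v) q))))
      where
      lemma : ∀ a b c d e → (((a + b) + c) + d) + e ≡ (((e + b) + c) + d) + a
      lemma = solve-∀
    ends₁ : ∀ z → ∑ (ends z) (family free thru₁) + δ z c ≡ ∑ (ends z) (family free thru) + δ z w
    ends₁ z = trans (cong (_+ δ z c) (trans (∑-↭ (ends z) q₁)
        (cong (_+ ∑ (ends z) R) (trans (ends-ʳ++ z x (c ∷ cs) B) (cong (λ e → δ z e + δ z (last x B)) lst)))))
      (trans (lemma (δ z w) (δ z (last x B)) (∑ (ends z) R) (δ z c))
        (cong (_+ δ z w) (sym (trans (∑-↭ (ends z) q)
          (cong (_+ ∑ (ends z) R) (ends-ʳ++ z x (w ∷ as) B))))))
      where
      lemma : ∀ a b c d → ((a + b) + c) + d ≡ ((d + b) + c) + a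
      lemma = solve-∀
    moved : Inserted x w (family free thru₁) → Inserted x c (family free thru)
    moved (D′ , s , u , e) = D′ , s , (λ a b → trans (u a b) (uses₁ a b))
      -- The path end at `w` created by the reversal is the one spent by the recursive insertion, so
      -- `δ z w` cancels.
      , λ z → +-cancelʳ-≡ (δ z w) _ _ (trans (lemma₁ _ (δ z c) (δ z w)) (trans (cong (_+ δ z c) (e z))
          (trans (lemma₁ _ (δ z x) (δ z c)) (trans (cong (_+ δ z x) (ends₁ z)) (lemma₁ _ (δ z w) (δ z x))))))
      where
      lemma₁ : ∀ a b c → (a + b) + c ≡ (a + c) + b
      lemma₁ = solve-∀

  head#≤walk : ∀ w A → head# w A ≤ walk x w x A
  head#≤walk w []       = z≤n
  head#≤walk w (a ∷ as) = ≤-trans (≤-reflexive (trans (δ-sym w a)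
    (trans (sym (*-identityˡ _)) (cong (_* δ a w) (sym (δ-refl x))))))
    (≤-trans (m≤m+n _ _) (m≤m+n _ _))

  heads≤uses : ∀ w free thru → heads w thru ≤ ∑ (uses x w) (family free thru)
  heads≤uses w free thru = ≤-trans (∑-mono bound thru) (≤-trans (≤-reflexive (sym (∑-map (uses x w) glue thru)))
    (≤-trans (m≤n+m _ _) (≤-reflexive (sym (∑-++ (uses x w) free (map glue thru))))))
    where
    bound : ∀ p → head# w (proj₁ p) + head# w (proj₂ p) ≤ uses x w (glue p)
    bound (A , B) = ≤-trans (+-mono-≤ (head#≤walk w A) (head#≤walk w B))
                            (≤-reflexive (sym (uses-ʳ++ x w x A B)))

  -- Initially `S` holds the first vertices of all arms. Then `c ∉ S` because `x c` is uncovered,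
  -- and `x ∉ S` because there are no loops; so each vertex of `c ∷ S` differs from `x` and has a
  -- path end, either on a path avoiding `x` or at the tip of a nonempty arm.
  fan : ∀ c D → All Simple D → (∀ w → ∑ (uses x w) D ≤ 1)
    → ∑ (uses x x) D ≡ 0 → ∑ (uses x c) D ≡ 0 → c ≢ x
    → (∀ z → z ≢ x → 1 ≤ ∑ (ends z) D) → Inserted x c D
  fan c D sD use≤1 usex≡0 usec≡0 c≢x end with partition D
  ... | free , thru , p , x∉ = Inserted-resp-↭ p
        (insert (length S) S c free thru ≤-refl (unused usec≡0)
          (λ {w} _ → ≤-trans (heads≤ w) (use≤1 w)) supplied x∉ (All-resp-↭ p sD))
    where
    S : List (Fin n)
    S = filter (λ w → 1 ≤? heads w thru) (allFin n)
    heads≤ : ∀ w → heads w thru ≤ ∑ (uses x w) D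
    heads≤ w = ≤-trans (heads≤uses w free thru) (≤-reflexive (sym (∑-↭ (uses x w) p)))
    unused : ∀ {w} → ∑ (uses x w) D ≡ 0 → w ∉ S
    unused {w} eq w∈ = 1+n≰n (≤-trans (proj₂ (∈-filter⁻ (λ w → 1 ≤? heads w thru) {xs = allFin n} w∈))
                                     (≤-trans (heads≤ w) (≤-reflexive eq)))
    armTo : ∀ {z} A → z ≢ x → (∀ w → head# w A ≤ heads w thru) → 1 ≤ δ z (last x A) → ArmTo z S A
    armTo {z} []       z≢x h q = ⊥-elim (z≢x (δ-positive z x q))
    armTo {z} (a ∷ as) z≢x h q = a , as , refl , sym (δ-positive z (last a as) q)
      , ∈-filter⁺ (λ w → 1 ≤? heads w thru) (∈-allFin a) (≤-trans (≤-reflexive (sym (δ-refl a))) (h a))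
    supplied≢ : ∀ {z} → z ≢ x → Supplied S free thru z
    supplied≢ {z} z≢x with ∑-positive (ends z) (family free thru)
                             (≤-trans (end z z≢x) (≤-reflexive (∑-↭ (ends z) p)))
    ... | P , P∈ , q with ∈-++⁻ free P∈
    ...   | inj₁ P∈free = inj₁ (P , P∈free , q)
    ...   | inj₂ P∈map with ∈-map⁻ glue P∈map
    ...     | (A , B) , p∈ , refl with +-positive (δ z (last x A)) _ (≤-trans q (≤-reflexive (ends-ʳ++ z x A B)))
    ...       | inj₁ r = inj₂ (_ , p∈ , inj₁ (armTo A z≢x (λ w → ≤-trans (m≤m+n _ _) (∈⇒≤∑ (λ (A , B) → head# w A + head# w B) p∈)) r))
    ...       | inj₂ r = inj₂ (_ , p∈ , inj₂ (armTo B z≢x (λ w → ≤-trans (m≤n+m _ _) (∈⇒≤∑ (λ (A , B) → head# w A + head# w B) p∈)) r))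
    supplied : ∀ {z} → z ∈ c ∷ S → Supplied S free thru z
    supplied (here refl) = supplied≢ c≢x
    supplied (there z∈)  = supplied≢ λ { refl → unused usex≡0 z∈ }

-- Lovász decompositions

Edges : ℕ → Set
Edges n = List (Fin n × Fin n)

edgeCount : Fin n → Fin n → Edges n → ℕ
edgeCount u v = ∑ λ (a , b) → edge u v a b

deg : Fin n → Edges n → ℕ
deg z = ∑ λ (a , b) → δ z a + δ z b

record Proper (es : Edges n) : Set where
  field
    no-multiple : ∀ u v → edgeCount u v es ≤ 1
    no-loop     : ∀ u → edgeCount u u es ≡ 0
open Proper

-- Path decompositions do not see the order of the edge list or the orientation of its entries.
record _≃_ (es es′ : Edges n) : Set where
  field
    count-≃ : ∀ u v → edgeCount u v es ≡ edgeCount u v es′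
    deg-≃   : ∀ z → deg z es ≡ deg z es′
open _≃_

≃-sym : ∀ {es es′ : Edges n} → es ≃ es′ → es′ ≃ es
≃-sym e = record { count-≃ = λ u v → sym (count-≃ e u v) ; deg-≃ = λ z → sym (deg-≃ e z) }

≃-trans : ∀ {es es′ es″ : Edges n} → es ≃ es′ → es′ ≃ es″ → es ≃ es″
≃-trans e e′ = record
  { count-≃ = λ u v → trans (count-≃ e u v) (count-≃ e′ u v)
  ; deg-≃   = λ z → trans (deg-≃ e z) (deg-≃ e′ z) }

↭⇒≃ : ∀ {es es′ : Edges n} → es ↭ es′ → es ≃ es′
↭⇒≃ p = record { count-≃ = λ u v → ∑-↭ _ p ; deg-≃ = λ z → ∑-↭ _ p }

flip-≃ : ∀ (x y : Fin n) es → ((x , y) ∷ es) ≃ ((y , x) ∷ es)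
flip-≃ x y es = record
  { count-≃ = λ u v → cong (_+ edgeCount u v es) (edge-comm u v x y)
  ; deg-≃   = λ z → cong (_+ deg z es) (+-comm (δ z x) (δ z y)) }

Proper-resp-≃ : ∀ {es es′ : Edges n} → es ≃ es′ → Proper es → Proper es′
Proper-resp-≃ e p = record
  { no-multiple = λ u v → ≤-trans (≤-reflexive (sym (count-≃ e u v))) (no-multiple p u v)
  ; no-loop     = λ u → trans (sym (count-≃ e u u)) (no-loop p u) }

Proper-tail : ∀ {e} {es : Edges n} → Proper (e ∷ es) → Proper es
Proper-tail p = record
  { no-multiple = λ u v → ≤-trans (m≤n+m _ _) (no-multiple p u v)
  ; no-loop     = λ u → m+n≡0⇒n≡0 _ (no-loop p u) }

Proper-≢ : ∀ {x y} {es : Edges n} → Proper ((x , y) ∷ es) → x ≢ y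
Proper-≢ {x = x} p refl = 1+n≰n (≤-trans (edge-self x x) (≤-trans (m≤m+n _ _) (≤-reflexive (no-loop p x))))

Decomposes : Edges n → (Fin n → ℕ) → Set
Decomposes {n} es f = Σ (List (List (Fin n))) λ D → All Simple D
  × (∀ u v → ∑ (uses u v) D ≡ edgeCount u v es)
  × (∀ z → ∑ (ends z) D ≡ f z)

Decomposes-resp-≃ : ∀ {es es′ : Edges n} {f g} → es ≃ es′ → (∀ z → f z ≡ g z) →
  Decomposes es f → Decomposes es′ g
Decomposes-resp-≃ e h (D , s , u , t) =
  D , s , (λ a b → trans (u a b) (count-≃ e a b)) , (λ z → trans (t z) (h z))

-- With the fan centred at `x`, one path end moves from `y` to `x`. Ends are demanded at all
-- vertices but `x`, so `x` may have been vacated before.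
add-edge : ∀ x y {es : Edges n} {f} g → Proper ((x , y) ∷ es) → Decomposes es f
  → (∀ z → z ≢ x → 1 ≤ f z) → (∀ z → g z + δ z y ≡ f z + δ z x)
  → Decomposes ((x , y) ∷ es) g
add-edge x y {es} g pr (D , s , u , t) f≥1 h
  with Fan.fan x y D s
    (λ w → ≤-trans (≤-reflexive (u x w)) (no-multiple (Proper-tail pr) x w))
    (trans (u x x) (no-loop (Proper-tail pr) x))
    (trans (u x y) (n≤0⇒n≡0 (+-cancelˡ-≤ 1 _ _ (≤-trans (+-monoˡ-≤ _ (edge-self x y)) (no-multiple pr x y)))))
    (λ e → Proper-≢ pr (sym e))
    (λ z z≢x → ≤-trans (f≥1 z z≢x) (≤-reflexive (sym (t z))))
... | D′ , s′ , u′ , t′ = D′ , s′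
  , (λ a b → trans (u′ a b) (trans (cong (_+ edge a b x y) (u a b)) (+-comm _ (edge a b x y))))
  , λ z → +-cancelʳ-≡ (δ z y) _ _ (trans (t′ z) (trans (cong (_+ δ z x) (t z)) (sym (h z))))

-- The number of path ends at a vertex of degree k.
quota : ℕ → ℕ
quota zero          = 2
quota (suc zero)    = 1
quota (suc (suc k)) = quota k

quota-cases : ∀ k → (quota k ≡ 1 × quota (suc k) ≡ 2) ⊎ (quota k ≡ 2 × quota (suc k) ≡ 1)
quota-cases zero          = inj₂ (refl , refl)
quota-cases (suc zero)    = inj₁ (refl , refl)
quota-cases (suc (suc k)) = quota-cases k

quota-pred : ∀ k → quota (suc k) ≡ 2 → quota k ≡ 1
quota-pred k p with quota-cases k
... | inj₁ (q , _) = q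
... | inj₂ (_ , q) with trans (sym p) q
...   | ()

quota-pred′ : ∀ k → quota (suc k) ≡ 1 → quota k ≡ 2
quota-pred′ k p with quota-cases k
... | inj₂ (q , _) = q
... | inj₁ (_ , q) with trans (sym p) q
...   | ()

quota≥1 : ∀ k → 1 ≤ quota k
quota≥1 k with quota-cases k
... | inj₁ (q , _) = ≤-reflexive (sym q)
... | inj₂ (q , _) = ≤-trans (s≤s z≤n) (≤-reflexive (sym q))

quota≤2 : ∀ k → quota k ≤ 2
quota≤2 k with quota-cases k
... | inj₁ (q , _) = ≤-trans (≤-reflexive q) (s≤s z≤n)
... | inj₂ (q , _) = ≤-reflexive q

full : Edges n → Fin n → ℕ
full es z = quota (deg z es)

-- The induction on the edges also needs decompositions without path ends at a given even
-- vertex x: an edge x y re-inserted from y moves a path end from x to y, and adding the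
-- one-vertex path at x turns such a decomposition into a full one.
vacate : Edges n → Fin n → Fin n → ℕ
vacate es x z = if does (z ≟ x) then 0 else full es z

Full : Edges n → Set
Full es = Decomposes es (full es)

Vacating : Edges n → Set
Vacating {n} es = ∀ x → full es x ≡ 2 → Decomposes es (vacate es x)

full-resp-≃ : ∀ (es es′ : Edges n) → es ≃ es′ → ∀ z → full es z ≡ full es′ z
full-resp-≃ es es′ e z = cong quota (deg-≃ e z)

vacate-resp-≃ : ∀ (es es′ : Edges n) → es ≃ es′ → ∀ x z → vacate es x z ≡ vacate es′ x z
vacate-resp-≃ es es′ e x z with z ≟ x
... | yes _ = refl
... | no _  = full-resp-≃ es es′ e z

full-empty : Full {n} []
full-empty {n} = map (_∷ []) (allFin n) , Allₚ.map⁺ (All.tabulate λ {a} _ z → ≤-trans (≤-reflexive (+-identityʳ _)) (δ-≤1 z a))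
  , (λ u v → trans (∑-map (uses u v) (_∷ []) (allFin n)) (∑-0 (λ _ → refl) (allFin n)))
  , λ z → trans (∑-map (ends z) (_∷ []) (allFin n))
      (trans (∑-+ (δ z) (δ z) (allFin n)) (cong₂ _+_ (∑δ-one z) (∑δ-one z)))

-- Without the edge, `x` is odd and has a single path end, which a fan centred at `y` moves to `y`.
-- An odd `y` goes from one end to the required two; an even `y` is vacated first and then receives
-- the one it needs.
vacate-incident : ∀ x y {es : Edges n} → Proper ((x , y) ∷ es) → Full es → Vacating es
  → full ((x , y) ∷ es) x ≡ 2 → Decomposes ((x , y) ∷ es) (vacate ((x , y) ∷ es) x)
vacate-incident x y {es} pr F V even with quota-cases (deg y es)
... | inj₁ (odd-y , even-y) = Decomposes-resp-≃ (flip-≃ y x es) (λ _ → refl)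
      (add-edge y x (vacate ((x , y) ∷ es) x) (Proper-resp-≃ (flip-≃ x y es) pr) F
        (λ z _ → quota≥1 (deg z es)) balance)
  where
  odd-x : quota (deg x es) ≡ 1
  odd-x = quota-pred (deg x es) (trans (cong (λ k → quota (k + deg x es))
    (sym (cong₂ _+_ (δ-refl x) (δ-≢ (Proper-≢ pr))))) even)
  balance : ∀ z → vacate ((x , y) ∷ es) x z + δ z x ≡ full es z + δ z y
  balance z with z ≟ x | z ≟ y
  ... | yes refl | yes refl = ⊥-elim (Proper-≢ pr refl)
  ... | yes refl | no _     = sym (cong (_+ 0) odd-x)
  ... | no _     | yes refl = trans (cong (_+ 0) even-y) (sym (cong (_+ 1) odd-y))
  ... | no _     | no _     = refl
... | inj₂ (even-y , odd-y) = Decomposes-resp-≃ (flip-≃ y x es) (λ _ → refl)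
      (add-edge y x (vacate ((x , y) ∷ es) x) (Proper-resp-≃ (flip-≃ x y es) pr) (V y even-y)
        positive balance)
  where
  odd-x : quota (deg x es) ≡ 1
  odd-x = quota-pred (deg x es) (trans (cong (λ k → quota (k + deg x es))
    (sym (cong₂ _+_ (δ-refl x) (δ-≢ (Proper-≢ pr))))) even)
  positive : ∀ z → z ≢ y → 1 ≤ vacate es y z
  positive z z≢y with z ≟ y
  ... | yes e = ⊥-elim (z≢y e)
  ... | no _  = quota≥1 (deg z es)
  balance : ∀ z → vacate ((x , y) ∷ es) x z + δ z x ≡ vacate es y z + δ z y
  balance z with z ≟ x | z ≟ y
  ... | yes refl | yes refl = ⊥-elim (Proper-≢ pr refl)
  ... | yes refl | no _     = sym (cong (_+ 0) odd-x)
  ... | no _     | yes refl = cong (_+ 0) odd-y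
  ... | no _     | no _     = refl

refill : ∀ (es : Edges n) x → full es x ≡ 2 → Decomposes es (vacate es x) → Full es
refill es x even (D , s , u , t) = (x ∷ []) ∷ D
  , (λ z → ≤-trans (≤-reflexive (+-identityʳ _)) (δ-≤1 z x)) ∷ s , u , λ z → trans (cong (δ z x + δ z x +_) (t z)) (balance z)
  where
  balance : ∀ z → δ z x + δ z x + vacate es x z ≡ full es z
  balance z with z ≟ x
  ... | yes refl = sym even
  ... | no _     = refl

-- If `x` or `y` becomes even, that vertex is vacated and refilled. If both become odd, both were
-- even: starting from a decomposition vacated at `x`, one of the two ends at `y` moves to `x`.
full-cons : ∀ x y {es : Edges n} → Proper ((x , y) ∷ es) → Full es → Vacating es → Full ((x , y) ∷ es)
full-cons x y {es} pr F V with quota-cases (deg x ((x , y) ∷ es)) | quota-cases (deg y ((x , y) ∷ es))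
... | inj₂ (even , _) | _ = refill ((x , y) ∷ es) x even (vacate-incident x y pr F V even)
... | inj₁ _ | inj₂ (even , _) = Decomposes-resp-≃ (flip-≃ y x es) (full-resp-≃ ((y , x) ∷ es) ((x , y) ∷ es) (flip-≃ y x es))
      (refill ((y , x) ∷ es) y even′ (vacate-incident y x (Proper-resp-≃ (flip-≃ x y es) pr) F V even′))
  where
  even′ : full ((y , x) ∷ es) y ≡ 2
  even′ = trans (full-resp-≃ ((y , x) ∷ es) ((x , y) ∷ es) (flip-≃ y x es) y) even
... | inj₁ (odd-x , _) | inj₁ (odd-y , _) = add-edge x y (full ((x , y) ∷ es)) pr (V x even-x) positive balance
  where
  even-x : quota (deg x es) ≡ 2
  even-x = quota-pred′ (deg x es) (trans (cong (λ k → quota (k + deg x es))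
    (sym (cong₂ _+_ (δ-refl x) (δ-≢ (Proper-≢ pr))))) odd-x)
  even-y : quota (deg y es) ≡ 2
  even-y = quota-pred′ (deg y es) (trans (cong (λ k → quota (k + deg y es))
    (sym (cong₂ _+_ (δ-≢ (Proper-≢ pr ∘ sym)) (δ-refl y)))) odd-y)
  positive : ∀ z → z ≢ x → 1 ≤ vacate es x z
  positive z z≢x with z ≟ x
  ... | yes e = ⊥-elim (z≢x e)
  ... | no _  = quota≥1 (deg z es)
  balance : ∀ z → full ((x , y) ∷ es) z + δ z y ≡ vacate es x z + δ z x
  balance z with z ≟ x | z ≟ y
  ... | yes refl | yes refl = ⊥-elim (Proper-≢ pr refl)
  ... | yes refl | no _     = cong (_+ 0) (trans lemma odd-x)
    where
    lemma : quota (suc (deg z es)) ≡ quota (δ z z + δ z y + deg z es)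
    lemma = cong (λ k → quota (k + deg z es)) (sym (cong₂ _+_ (δ-refl z) (δ-≢ (Proper-≢ pr))))
  ... | no z≢x   | yes refl = trans (cong (_+ 1) (trans lemma odd-y)) (sym (cong (_+ 0) even-y))
    where
    lemma : quota (suc (deg z es)) ≡ quota (δ z x + δ z z + deg z es)
    lemma = cong (λ k → quota (k + deg z es)) (sym (cong₂ _+_ (δ-≢ z≢x) (δ-refl z)))
  ... | no _     | no _     = refl

edgeCount≤deg : ∀ u v (es : Edges n) → edgeCount u v es ≤ deg u es
edgeCount≤deg u v = ∑-mono λ (a , b) → +-mono-≤
  (≤-trans (*-monoʳ-≤ (δ a u) (δ-≤1 b v)) (≤-reflexive (trans (*-identityʳ _) (δ-sym a u))))
  (≤-trans (*-monoˡ-≤ (δ b u) (δ-≤1 a v)) (≤-reflexive (trans (+-identityʳ _) (δ-sym b u))))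

-- A path with an end at `x` is a single vertex, as its first edge would give `x` positive degree.
-- Dropping it removes both ends that the quota prescribes at `x`.
vacate-isolated : ∀ (es : Edges n) x → deg x es ≡ 0 → Full es → Decomposes es (vacate es x)
vacate-isolated {n} es x iso (D , s , u , t)
  with ∑-positive (ends x) D (≤-trans (quota≥1 (deg x es)) (≤-reflexive (sym (t x))))
... | P , P∈ , q with start-at x P q | ∈⇒↭ P∈
...   | b ∷ bs , same | D′ , p = ⊥-elim (1+n≰n (≤-trans (edge-self x b) (≤-trans (m≤m+n _ _)
        (≤-trans (≤-reflexive (uses-≈ same x b)) (≤-trans (∈⇒≤∑ (uses x b) P∈)
        (≤-trans (≤-reflexive (u x b)) (≤-trans (edgeCount≤deg x b es) (≤-reflexive iso))))))))
...   | [] , same | D′ , p = D′ , tail (All-resp-↭ p s)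
        , (λ a b → trans (cong (_+ ∑ (uses a b) D′) (uses-≈ same a b)) (trans (sym (∑-↭ (uses a b) p)) (u a b)))
        , λ z → balance z (trans (cong (_+ ∑ (ends z) D′) (ends-≈ same z)) (trans (sym (∑-↭ (ends z) p)) (t z)))
  where
  tail : All Simple (P ∷ D′) → All Simple D′
  tail (_ ∷ s) = s
  balance : ∀ z → δ z x + δ z x + ∑ (ends z) D′ ≡ full es z → ∑ (ends z) D′ ≡ vacate es x z
  balance z eq with z ≟ x
  ... | yes refl = +-cancelˡ-≡ 2 _ _ (trans eq (cong quota iso))
  ... | no _     = eq

-- `V` takes away an edge at the prescribed vertex, wherever it stands in the list and whichever way
-- round, so the induction is on the length. At equal length `V` calls `F`, when `x` is isolated,
-- but `F` never calls `V`.
lovász : ∀ k (es : Edges n) → length es ≡ k → Proper es → Full es × Vacating es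
lovász {n} k es len pr = F k es len pr , V k es len pr
  where
  incident : ∀ x (es : Edges n) → deg x es ≡ 0 ⊎ ∃ λ y → ∃ λ es′ → es ≃ ((x , y) ∷ es′) × length es ≡ suc (length es′)
  incident x es with deg x es in eq
  ... | zero  = inj₁ refl
  ... | suc d with ∑-positive (λ (a , b) → δ x a + δ x b) es (subst (1 ≤_) (sym eq) (s≤s z≤n))
  ...   | (a , b) , e∈ , q with ∈⇒↭ e∈ | +-positive (δ x a) _ q
  ...     | es′ , p | inj₁ r with refl ← δ-positive x a r = inj₂ (b , es′ , ↭⇒≃ p , ↭-length p)
  ...     | es′ , p | inj₂ r with refl ← δ-positive x b r =
              inj₂ (a , es′ , ≃-trans (↭⇒≃ p) (flip-≃ a x es′) , ↭-length p)

  F : ∀ k (es : Edges n) → length es ≡ k → Proper es → Full es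
  V : ∀ k (es : Edges n) → length es ≡ k → Proper es → Vacating es
  F zero    []             _   _  = full-empty
  F (suc k) ((x , y) ∷ es) len pr = full-cons x y pr
    (F k es (suc-injective len) (Proper-tail pr)) (V k es (suc-injective len) (Proper-tail pr))
  V k es len pr x even with incident x es
  ... | inj₁ iso = vacate-isolated es x iso (F k es len pr)
  V zero    [] len pr x even | inj₂ (y , es′ , _ , ())
  V (suc k) es len pr x even | inj₂ (y , es′ , e , len′) =
    Decomposes-resp-≃ (≃-sym e) (vacate-resp-≃ ((x , y) ∷ es′) es (≃-sym e) x)
      (vacate-incident x y pr′ (F k es′ len″ (Proper-tail pr′)) (V k es′ len″ (Proper-tail pr′))
        (trans (sym (full-resp-≃ es ((x , y) ∷ es′) e x)) even))
    where
    pr′ : Proper ((x , y) ∷ es′)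
    pr′ = Proper-resp-≃ e pr
    len″ : length es′ ≡ k
    len″ = suc-injective (trans (sym len′) len)

-- The edge list of an adjacency function

∑-filterᵇ : ∀ (f : A → ℕ) p xs → ∑ f (filterᵇ p xs) ≡ ∑ (λ x → ⟦ p x ⟧ * f x) xs
∑-filterᵇ f p []       = refl
∑-filterᵇ f p (x ∷ xs) with p x
... | true  = cong₂ _+_ (sym (+-identityʳ (f x))) (∑-filterᵇ f p xs)
... | false = ∑-filterᵇ f p xs

∑-cartesianProduct : ∀ (f : A × B → ℕ) xs ys →
  ∑ f (cartesianProduct xs ys) ≡ ∑ (λ x → ∑ (λ y → f (x , y)) ys) xs
∑-cartesianProduct f []       ys = refl
∑-cartesianProduct f (x ∷ xs) ys = trans (∑-++ f (map (x ,_) ys) _)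
  (cong₂ _+_ (∑-map f (x ,_) ys) (∑-cartesianProduct f xs ys))

∑∑δ : ∀ (u v : Fin n) (W : Fin n → Fin n → ℕ) →
  ∑ (λ a → ∑ (λ b → W a b * (δ a u * δ b v)) (allFin n)) (allFin n) ≡ W u v
∑∑δ {n} u v W = trans (∑-cong inner (allFin n)) (∑δ u (λ a → W a v))
  where
  lemma : ∀ w x y → w * (x * y) ≡ x * (y * w)
  lemma = solve-∀
  inner : ∀ a → ∑ (λ b → W a b * (δ a u * δ b v)) (allFin n) ≡ δ u a * W a v
  inner a = trans (∑-cong (λ b → trans (lemma (W a b) (δ a u) (δ b v))
                                       (cong₂ (λ d e → d * (e * W a b)) (δ-sym a u) (δ-sym b v))) (allFin n))
    (trans (∑-*ˡ (δ u a) (λ b → δ v b * W a b) (allFin n)) (cong (δ u a *_) (∑δ v (W a))))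

edgesOf : Adj n → Edges n
edgesOf {n} H = filterᵇ (λ (a , b) → does (a <? b) ∧ H a b) (cartesianProduct (allFin n) (allFin n))

edgeCount-edgesOf : ∀ {H : Adj n} → IsSimple H → ∀ u v → edgeCount u v (edgesOf H) ≡ ⟦ H u v ⟧
edgeCount-edgesOf {n} {H} simple u v = begin
  edgeCount u v (edgesOf H)
    ≡⟨ ∑-filterᵇ (λ (a , b) → edge u v a b) (λ (a , b) → does (a <? b) ∧ H a b) (cartesianProduct V V) ⟩
  ∑ (λ (a , b) → W a b * edge u v a b) (cartesianProduct V V)
    ≡⟨ ∑-cartesianProduct (λ (a , b) → W a b * edge u v a b) V V ⟩
  ∑ (λ a → ∑ (λ b → W a b * edge u v a b) V) V
    ≡⟨ ∑-cong (λ a → trans (∑-cong (λ b → *-distribˡ-+ (W a b) (δ a u * δ b v) (δ a v * δ b u)) V)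
                           (∑-+ (λ b → W a b * (δ a u * δ b v)) (λ b → W a b * (δ a v * δ b u)) V)) V ⟩
  ∑ (λ a → ∑ (λ b → W a b * (δ a u * δ b v)) V + ∑ (λ b → W a b * (δ a v * δ b u)) V) V
    ≡⟨ ∑-+ (λ a → ∑ (λ b → W a b * (δ a u * δ b v)) V) (λ a → ∑ (λ b → W a b * (δ a v * δ b u)) V) V ⟩
  ∑ (λ a → ∑ (λ b → W a b * (δ a u * δ b v)) V) V + ∑ (λ a → ∑ (λ b → W a b * (δ a v * δ b u)) V) V
    ≡⟨ cong₂ _+_ (∑∑δ u v W) (∑∑δ v u W) ⟩
  W u v + W v u
    ≡⟨ total ⟩
  ⟦ H u v ⟧ ∎
  where
  open ≡-Reasoning
  V : List (Fin n)
  V = allFin n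
  W : Fin n → Fin n → ℕ
  W a b = ⟦ does (a <? b) ∧ H a b ⟧
  -- The test `a < b` admits exactly one of the two orientations of an edge.
  total : W u v + W v u ≡ ⟦ H u v ⟧
  total with <-cmp u v
  ... | tri< u<v _ v≮u rewrite dec-true (u <? v) u<v | dec-false (v <? u) v≮u = +-identityʳ _
  ... | tri≈ u≮v refl _ rewrite dec-false (u <? u) u≮v | IsSimple.irrefl simple u = refl
  ... | tri> u≮v _ v<u rewrite dec-false (u <? v) u≮v | dec-true (v <? u) v<u = cong ⟦_⟧ (IsSimple.symm simple v u)

⟦⟧≤1 : ∀ b → ⟦ b ⟧ ≤ 1
⟦⟧≤1 true  = ≤-refl
⟦⟧≤1 false = z≤n

edgesOf-proper : ∀ {H : Adj n} → IsSimple H → Proper (edgesOf H)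
edgesOf-proper {H = H} simple = record
  { no-multiple = λ u v → ≤-trans (≤-reflexive (edgeCount-edgesOf simple u v)) (⟦⟧≤1 (H u v))
  ; no-loop     = λ u → trans (edgeCount-edgesOf simple u u) (cong ⟦_⟧ (IsSimple.irrefl simple u)) }

-- Directed paths

DPath : ℕ → Set
DPath n = Fin n × List (Fin n)

toList : DPath n → List (Fin n)
toList (a , as) = a ∷ as

source target : DPath n → Fin n
source (a , as) = a
target (a , as) = last a as

usesᵈ : Fin n → Fin n → List (DPath n) → ℕ
usesᵈ u v = ∑ (uses u v ∘ toList)

sources targets : Fin n → List (DPath n) → ℕ
sources z = ∑ (δ z ∘ source)
targets z = ∑ (δ z ∘ target)

-- Directed paths which compose to a trail from one vertex to another, visiting the vertices
-- counted by inner in between.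
record Chain (n : ℕ) : Set where
  field
    from to   : Fin n
    inner     : Fin n → ℕ
    links     : List (DPath n)
    links-simple : All (Simple ∘ toList) links
    sources-≡ : ∀ z → sources z links ≡ δ z from + inner z
    targets-≡ : ∀ z → targets z links ≡ inner z + δ z to
open Chain

usesᶜ : Fin n → Fin n → Chain n → ℕ
usesᶜ u v c = usesᵈ u v (links c)

-- By the equations of `Chain`, this is the number of path ends that the links have at `z`.
weight : Fin n → Chain n → ℕ
weight z c = (δ z (from c) + inner c z) + (inner c z + δ z (to c))

reverse-all : ∀ (qs : List (DPath n)) → All (Simple ∘ toList) qs → ∃ λ ps → All (Simple ∘ toList) ps
  × (∀ u v → usesᵈ u v ps ≡ usesᵈ u v qs)
  × (∀ z → sources z ps ≡ targets z qs) × (∀ z → targets z ps ≡ sources z qs)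
reverse-all []              []       = [] , [] , (λ _ _ → refl) , (λ _ → refl) , (λ _ → refl)
reverse-all ((a , as) ∷ qs) (s ∷ ss) with reverse-all qs ss | reverse-≈ a as
... | ps , sp , u , f , t | bs , lst , same = (last a as , bs) ∷ ps
  , (λ z → ≤-trans (≤-reflexive (occ-≈ same z)) (s z)) ∷ sp
  , (λ x y → cong₂ _+_ (uses-≈ same x y) (u x y))
  , (λ z → cong (δ z (last a as) +_) (f z))
  , (λ z → cong₂ _+_ (cong (δ z) lst) (t z))

reverse-chain : (c : Chain n) → ∃ λ d → from d ≡ to c × to d ≡ from c
  × (∀ u v → usesᶜ u v d ≡ usesᶜ u v c) × (∀ z → weight z d ≡ weight z c)
reverse-chain c with reverse-all (links c) (links-simple c)
... | ps , sp , u , f , t = record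
    { from = to c ; to = from c ; inner = inner c ; links = ps ; links-simple = sp
    ; sources-≡ = λ z → trans (f z) (trans (targets-≡ c z) (+-comm (inner c z) _))
    ; targets-≡ = λ z → trans (t z) (trans (sources-≡ c z) (+-comm _ (inner c z))) }
  , refl , refl , u , λ z → lemma (δ z (to c)) (inner c z) (δ z (from c))
  where
  lemma : ∀ x y w → (x + y) + (y + w) ≡ (w + y) + (y + x)
  lemma = solve-∀

Joined : Chain n → Chain n → Set
Joined c d = ∃ λ j → (∀ u v → usesᶜ u v j ≡ usesᶜ u v c + usesᶜ u v d)
                   × (∀ z → weight z j ≡ weight z c + weight z d)

join : (c d : Chain n) → to c ≡ from d → Joined c d
join c d eq = record
    { from = from c ; to = to d ; inner = λ z → (inner c z + δ z (to c)) + inner d z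
    ; links = links c ++ links d ; links-simple = Allₚ.++⁺ (links-simple c) (links-simple d)
    ; sources-≡ = λ z → trans (∑-++ (δ z ∘ source) (links c) (links d))
        (trans (cong₂ _+_ (sources-≡ c z) (trans (sources-≡ d z) (cong (λ e → δ z e + inner d z) (sym eq))))
               (lemma₁ (δ z (from c)) (inner c z) (δ z (to c)) (inner d z)))
    ; targets-≡ = λ z → trans (∑-++ (δ z ∘ target) (links c) (links d))
        (trans (cong₂ _+_ (targets-≡ c z) (targets-≡ d z))
               (lemma₂ (inner c z) (δ z (to c)) (inner d z) (δ z (to d)))) }
  , (λ u v → ∑-++ (uses u v ∘ toList) (links c) (links d))
  , λ z → trans (lemma₃ (δ z (from c)) (inner c z) (δ z (to c)) (inner d z) (δ z (to d)))
      (cong (λ e → weight z c + ((δ z e + inner d z) + (inner d z + δ z (to d)))) eq)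
  where
  lemma₁ : ∀ x y w k → (x + y) + (w + k) ≡ x + ((y + w) + k)
  lemma₁ = solve-∀
  lemma₂ : ∀ x y w k → (x + y) + (w + k) ≡ ((x + y) + w) + k
  lemma₂ = solve-∀
  lemma₃ : ∀ f i t j g → (f + ((i + t) + j)) + (((i + t) + j) + g)
                       ≡ ((f + i) + (i + t)) + ((t + j) + (j + g))
  lemma₃ = solve-∀

Joined-comm : ∀ {c d : Chain n} → Joined c d → Joined d c
Joined-comm {c = c} {d} (j , u , w) = j
  , (λ x y → trans (u x y) (+-comm (usesᶜ x y c) (usesᶜ x y d)))
  , λ z → trans (w z) (+-comm (weight z c) (weight z d))

meet : Chain n → Chain n → ℕ
meet c d = (δ (to c) (from d) + δ (to c) (to d)) + (δ (from c) (from d) + δ (from c) (to d))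

join-meeting : ∀ (c d : Chain n) → 1 ≤ meet c d → Joined c d
join-meeting c d p with +-positive (δ (to c) (from d) + δ (to c) (to d)) _ p
... | inj₁ q with +-positive (δ (to c) (from d)) _ q
...   | inj₁ r = join c d (δ-positive (to c) (from d) r)
...   | inj₂ r with reverse-chain d
...     | e , f , _ , u , w with join c e (trans (δ-positive (to c) (to d) r) (sym f))
...       | j , u′ , w′ = j , (λ x y → trans (u′ x y) (cong (usesᶜ x y c +_) (u x y)))
                            , λ z → trans (w′ z) (cong (weight z c +_) (w z))
join-meeting c d p | inj₂ q with +-positive (δ (from c) (from d)) _ q
... | inj₂ r = Joined-comm {c = d} {c} (join d c (sym (δ-positive (from c) (to d) r)))
... | inj₁ r with reverse-chain c
...   | e , _ , t , u , w with join e d (trans t (δ-positive (from c) (from d) r))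
...     | j , u′ , w′ = j , (λ x y → trans (u′ x y) (cong (_+ usesᶜ x y d) (u x y)))
                          , λ z → trans (w′ z) (cong (_+ weight z d) (w z))

-- Inner vertices contribute an even amount, so weight 1 must come from `from` or `to`.
weight-one : ∀ (z : Fin n) c → weight z c ≡ 1 → z ≡ from c ⊎ z ≡ to c
weight-one z c eq with +-positive (δ z (from c)) (δ z (to c)) (positive (δ z (from c)) (inner c z) (δ z (to c)) eq)
  where
  positive : ∀ x i y → (x + i) + (i + y) ≡ 1 → 1 ≤ x + y
  positive (suc x) i       y       _ = s≤s z≤n
  positive zero    zero    (suc y) _ = s≤s z≤n
  positive zero    (suc i) y       e with trans (sym (+-suc i (i + y))) (suc-injective e)
  ... | ()
... | inj₁ p = inj₁ (δ-positive z (from c) p)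
... | inj₂ p = inj₂ (δ-positive z (to c) p)

meet-common : ∀ (z : Fin n) c d → z ≡ from c ⊎ z ≡ to c → z ≡ from d ⊎ z ≡ to d → 1 ≤ meet c d
meet-common z c d = go
  where
  equal : ∀ {x y} → z ≡ x → z ≡ y → 1 ≤ δ x y
  equal refl refl = ≤-reflexive (sym (δ-refl z))
  go : z ≡ from c ⊎ z ≡ to c → z ≡ from d ⊎ z ≡ to d → 1 ≤ meet c d
  to-c from-c : ℕ
  to-c   = δ (to c) (from d) + δ (to c) (to d)
  from-c = δ (from c) (from d) + δ (from c) (to d)
  go (inj₁ e) (inj₁ f) = ≤-trans (equal e f) (≤-trans (m≤m+n _ (δ (from c) (to d))) (m≤n+m from-c to-c))
  go (inj₁ e) (inj₂ f) = ≤-trans (equal e f) (≤-trans (m≤n+m _ (δ (from c) (from d))) (m≤n+m from-c to-c))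
  go (inj₂ e) (inj₁ f) = ≤-trans (equal e f) (≤-trans (m≤m+n _ (δ (to c) (to d))) (m≤m+n to-c from-c))
  go (inj₂ e) (inj₂ f) = ≤-trans (equal e f) (≤-trans (m≤n+m _ (δ (to c) (from d))) (m≤m+n to-c from-c))

-- Directing all paths consistently

record Oriented (use : Fin n → Fin n → ℕ) (w : Fin n → ℕ) : Set where
  field
    paths     : List (DPath n)
    simple    : All (Simple ∘ toList) paths
    uses-≡    : ∀ u v → usesᵈ u v paths ≡ use u v
    total     : ∀ z → sources z paths + targets z paths ≡ w z
    sources≤1 : ∀ z → sources z paths ≤ 1
    targets≤1 : ∀ z → targets z paths ≤ 1

small-sum : ∀ x i y → x ≤ 1 → (x + i) + (i + y) ≤ 2 → x + i ≤ 1
small-sum zero       zero          y p q = z≤n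
small-sum zero       (suc zero)    y p q = ≤-refl
small-sum zero       (suc (suc i)) y p q = ⊥-elim (contra q)
  where
  contra : ¬ (suc (suc i) + (suc (suc i) + y) ≤ 2)
  contra (s≤s (s≤s q)) = 1+n≰n (≤-trans (s≤s z≤n) (≤-trans (m≤n+m (suc (suc i) + y) i) (≤-trans q z≤n)))
small-sum (suc zero) zero          y p q = ≤-refl
small-sum (suc zero) (suc i)       y p q = ⊥-elim (contra q)
  where
  contra : ¬ (suc (suc i) + (suc i + y) ≤ 2)
  contra (s≤s (s≤s q)) = 1+n≰n (≤-trans (s≤s z≤n) (≤-trans (m≤n+m (suc i + y) i) (≤-trans q z≤n)))
small-sum (suc (suc x)) i y (s≤s ()) q

both-positive : ∀ x y → 1 ≤ x → 1 ≤ y → x + y ≤ 2 → x ≡ 1 × y ≡ 1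
both-positive (suc zero) (suc zero) p q r = refl , refl
both-positive (suc zero) (suc (suc y)) p q (s≤s (s≤s ()))
both-positive (suc (suc x)) (suc y) p q (s≤s (s≤s r)) with trans (sym (+-suc x y)) (n≤0⇒n≡0 r)
... | ()

-- Chains with a common end are merged, one of them reversed if necessary, until the first chain
-- meets no other; then it is set aside. Within a chain, weight at most 2 leaves at most one source
-- and one target at each vertex, a closed chain included.
orient : ∀ k (cs : List (Chain n)) → length cs ≡ k → (∀ z → ∑ (weight z) cs ≤ 2)
  → Oriented (λ u v → ∑ (usesᶜ u v) cs) (λ z → ∑ (weight z) cs)
orient zero    []       len w≤2 = record
  { paths = [] ; simple = [] ; uses-≡ = λ _ _ → refl ; total = λ _ → refl
  ; sources≤1 = λ _ → z≤n ; targets≤1 = λ _ → z≤n }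
orient (suc k) (c ∷ cs) len w≤2 with ∑ (meet c) cs in meets
... | suc _ with ∑-positive (meet c) cs (subst (1 ≤_) (sym meets) (s≤s z≤n))
...   | d , d∈ , q with ∈⇒↭ d∈ | join-meeting c d q
...     | ds , p | j , u , w = transfer (orient k (j ∷ ds) (suc-injective (trans (cong suc (sym (↭-length p))) len))
            λ z → ≤-trans (≤-reflexive (weights z)) (w≤2 z))
  where
  merge : ∀ (f : Chain _ → ℕ) → f j ≡ f c + f d → ∑ f (j ∷ ds) ≡ ∑ f (c ∷ cs)
  merge f eq = trans (cong (_+ ∑ f ds) eq) (trans (+-assoc (f c) (f d) _) (cong (f c +_) (sym (∑-↭ f p))))
  weights : ∀ z → ∑ (weight z) (j ∷ ds) ≡ ∑ (weight z) (c ∷ cs)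
  weights z = merge (weight z) (w z)
  transfer : Oriented (λ u v → ∑ (usesᶜ u v) (j ∷ ds)) (λ z → ∑ (weight z) (j ∷ ds)) →
             Oriented (λ u v → ∑ (usesᶜ u v) (c ∷ cs)) (λ z → ∑ (weight z) (c ∷ cs))
  transfer o = record
    { paths = Oriented.paths o ; simple = Oriented.simple o
    ; uses-≡ = λ x y → trans (Oriented.uses-≡ o x y) (merge (usesᶜ x y) (u x y))
    ; total = λ z → trans (Oriented.total o z) (weights z)
    ; sources≤1 = Oriented.sources≤1 o ; targets≤1 = Oriented.targets≤1 o }
orient (suc k) (c ∷ cs) len w≤2 | zero = record
  { paths = links c ++ paths ; simple = Allₚ.++⁺ (links-simple c) simple
  ; uses-≡ = λ u v → trans (∑-++ (uses u v ∘ toList) (links c) paths) (cong (usesᶜ u v c +_) (uses-≡ u v))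
  ; total = λ z → trans (cong₂ _+_ (∑-++ (δ z ∘ source) (links c) paths) (∑-++ (δ z ∘ target) (links c) paths))
      (trans (+-interchange (sources z (links c)) (sources z paths) (targets z (links c)) (targets z paths))
        (cong₂ _+_ (cong₂ _+_ (sources-≡ c z) (targets-≡ c z)) (total z)))
  ; sources≤1 = λ z → ≤-trans (≤-reflexive (∑-++ (δ z ∘ source) (links c) paths)) (bound-sources z (separate z))
  ; targets≤1 = λ z → ≤-trans (≤-reflexive (∑-++ (δ z ∘ target) (links c) paths)) (bound-targets z (separate z)) }
  where
  open Oriented (orient k cs (suc-injective len) (λ z → ≤-trans (m≤n+m _ _) (w≤2 z)))
  -- If both weights were positive, both would be 1, making `z` an end of `c` and of another chain,
  -- against `meets`.
  separate : ∀ z → weight z c ≡ 0 ⊎ ∑ (weight z) cs ≡ 0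
  separate z with weight z c in eq | ∑ (weight z) cs in eq′
  ... | zero  | _    = inj₁ refl
  ... | suc _ | zero = inj₂ refl
  ... | suc x | suc y with both-positive (weight z c) (∑ (weight z) cs)
            (subst (1 ≤_) (sym eq) (s≤s z≤n)) (subst (1 ≤_) (sym eq′) (s≤s z≤n)) (w≤2 z)
  ...   | one , one′ with ∑-positive (weight z) cs (≤-reflexive (sym one′))
  ...     | d , d∈ , q = ⊥-elim (1+n≰n (≤-trans (meet-common z c d (weight-one z c one)
              (weight-one z d (≤-antisym (≤-trans (∈⇒≤∑ (weight z) d∈) (≤-reflexive one′)) q)))
              (≤-trans (∈⇒≤∑ (meet c) d∈) (≤-reflexive meets))))
  bound-sources : ∀ z → weight z c ≡ 0 ⊎ ∑ (weight z) cs ≡ 0 → sources z (links c) + sources z paths ≤ 1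
  bound-sources z (inj₁ e) = ≤-trans (≤-reflexive (cong (_+ sources z paths)
    (trans (sources-≡ c z) (m+n≡0⇒m≡0 _ e)))) (sources≤1 z)
  bound-sources z (inj₂ e) = ≤-trans (≤-reflexive (trans (cong (sources z (links c) +_)
    (m+n≡0⇒m≡0 _ (trans (total z) e))) (trans (+-identityʳ _) (sources-≡ c z))))
    (small-sum (δ z (from c)) (inner c z) (δ z (to c)) (δ-≤1 z (from c)) (≤-trans (m≤m+n _ _) (w≤2 z)))
  bound-targets : ∀ z → weight z c ≡ 0 ⊎ ∑ (weight z) cs ≡ 0 → targets z (links c) + targets z paths ≤ 1
  bound-targets z (inj₁ e) = ≤-trans (≤-reflexive (cong (_+ targets z paths)
    (trans (targets-≡ c z) (m+n≡0⇒n≡0 (δ z (from c) + inner c z) e)))) (targets≤1 z)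
  bound-targets z (inj₂ e) = ≤-trans (≤-reflexive (trans (cong (targets z (links c) +_)
    (m+n≡0⇒n≡0 (sources z paths) (trans (total z) e))) (trans (+-identityʳ _) (trans (targets-≡ c z) (+-comm (inner c z) _)))))
    (small-sum (δ z (to c)) (inner c z) (δ z (from c)) (δ-≤1 z (to c))
      (≤-trans (≤-reflexive (lemma (δ z (to c)) (inner c z) (δ z (from c)))) (≤-trans (m≤m+n _ _) (w≤2 z))))
    where
    lemma : ∀ x y w → (x + y) + (y + w) ≡ (w + y) + (y + x)
    lemma = solve-∀

chains : (D : List (List (Fin n))) → All Simple D → ∃ λ cs →
  (∀ u v → ∑ (usesᶜ u v) cs ≡ ∑ (uses u v) D) × (∀ z → ∑ (weight z) cs ≡ ∑ (ends z) D)
chains []             []       = [] , (λ _ _ → refl) , λ _ → refl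
chains ([] ∷ D)       (_ ∷ ss) = chains D ss
chains ((a ∷ as) ∷ D) (s ∷ ss) with chains D ss
... | cs , u , w = record
      { from = a ; to = last a as ; inner = λ _ → 0 ; links = (a , as) ∷ [] ; links-simple = s ∷ []
      ; sources-≡ = λ _ → refl ; targets-≡ = λ z → +-identityʳ _ } ∷ cs
    , (λ x y → cong₂ _+_ (+-identityʳ _) (u x y))
    , λ z → cong₂ _+_ (cong (_+ δ z (last a as)) (+-identityʳ (δ z a))) (w z)

-- Linkages

-- In a linkage of H, a path link is a path of H; a break only pairs up a vertex where no path starts with a
-- vertex where no path ends.
data Link (n : ℕ) : Set where
  path  : Fin n → List (Fin n) → Link n
  break : Fin n → Fin n → Link n

start finish : Link n → Fin n
start (path a as)  = a
start (break a b)  = a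
finish (path a as) = last a as
finish (break a b) = b

vertices : Link n → List (Fin n)
vertices (path a as) = a ∷ as
vertices (break a b) = []

isBreak : Link n → ℕ
isBreak (path a as) = 0
isBreak (break a b) = 1

-- Both permutations matter: `n` paths arriving at the distinct vertices of a copy of `H` leave it
-- again at distinct vertices, ready for the `n` copies of the next edge of `G`.
record Linkage (H : Adj n) : Set where
  field
    links     : List (Link n)
    starts    : map start links ↭ allFin n
    finishes  : map finish links ↭ allFin n
    simple    : All (Simple ∘ vertices) links
    uses-≡    : ∀ u v → ∑ (uses u v ∘ vertices) links ≡ ⟦ H u v ⟧
    breaks    : 2 * ∑ isBreak links ≤ n

complete : ∀ (xs ys : List (Fin n)) → (∀ z → occ z xs ≤ occ z ys) → ∃ λ rs → xs ++ rs ↭ ys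
complete []       ys h = ys , ↭-refl
complete (x ∷ xs) ys h with ∑-positive (δ x) ys (≤-trans (≤-trans (≤-reflexive (sym (δ-refl x))) (m≤m+n _ _)) (h x))
... | y , y∈ , q with refl ← δ-positive x y q with ∈⇒↭ y∈
...   | ys′ , p with complete xs ys′ (λ z → +-cancelˡ-≤ (δ z x) _ _ (≤-trans (h z) (≤-reflexive (∑-↭ (δ z) p))))
...     | rs , r = rs , ↭-trans (prep x r) (↭-sym p)

pair-up : ∀ (rs ts : List (Fin n)) → length rs ≡ length ts → ∃ λ ls → map start ls ≡ rs × map finish ls ≡ ts
  × All (Simple ∘ vertices) ls × (∀ u v → ∑ (uses u v ∘ vertices) ls ≡ 0) × ∑ isBreak ls ≡ length rs
pair-up []       []       len = [] , refl , refl , [] , (λ _ _ → refl) , refl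
pair-up (r ∷ rs) (t ∷ ts) len with pair-up rs ts (suc-injective len)
... | ls , e , f , s , u , b = break r t ∷ ls , cong (r ∷_) e , cong (t ∷_) f , (λ _ → z≤n) ∷ s , u , cong suc b

linkage : ∀ {H : Adj n} → IsSimple H → Linkage H
linkage {n} {H} sH with proj₁ (lovász _ (edgesOf H) refl (edgesOf-proper sH))
... | D , sD , uD , eD with chains D sD
...   | cs , uc , wc = result
  where
  ends-cs : ∀ z → ∑ (weight z) cs ≡ full (edgesOf H) z
  ends-cs z = trans (wc z) (eD z)
  open Oriented (orient _ cs refl (λ z → ≤-trans (≤-reflexive (ends-cs z)) (quota≤2 (deg z (edgesOf H)))))

  unstarted : ∃ λ rs → map source paths ++ rs ↭ allFin n
  unstarted = complete (map source paths) (allFin n) λ z → ≤-trans (≤-reflexive (∑-map (δ z) source paths))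
         (≤-trans (sources≤1 z) (≤-reflexive (sym (∑δ-one z))))
  unfinished : ∃ λ ts → map target paths ++ ts ↭ allFin n
  unfinished = complete (map target paths) (allFin n) λ z → ≤-trans (≤-reflexive (∑-map (δ z) target paths))
         (≤-trans (targets≤1 z) (≤-reflexive (sym (∑δ-one z))))

  length-rest : ∀ {f : DPath n → Fin n} {rs} → map f paths ++ rs ↭ allFin n → length paths + length rs ≡ n
  length-rest {f} {rs} p = trans (cong (_+ length rs) (sym (length-map f paths)))
    (trans (sym (length-++ (map f paths))) (trans (↭-length p) (length-tabulate id)))

  count : ∀ (f : DPath n → Fin n) → ∑ (λ z → ∑ (δ z ∘ f) paths) (allFin n) ≡ length paths
  count f = trans (∑-swap (λ z q → δ z (f q)) (allFin n) paths)
    (trans (∑-cong (λ q → trans (∑-cong (λ z → δ-sym z (f q)) (allFin n)) (∑δ-one (f q))) paths) (∑-1 paths))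

  -- Each vertex of `H` is an end at least once and each path has two ends, so there are at least
  -- `n / 2` paths. The breaks make up the difference to `n`.
  many : n ≤ length paths + length paths
  many = ≤-trans (≤-reflexive (trans (sym (length-tabulate id)) (sym (∑-1 (allFin n)))))
    (≤-trans (∑-mono (λ z → ≤-trans (quota≥1 (deg z (edgesOf H)))
        (≤-reflexive (sym (trans (total z) (ends-cs z))))) (allFin n))
      (≤-reflexive (trans (∑-+ (λ z → sources z paths) (λ z → targets z paths) (allFin n))
        (cong₂ _+_ (count source) (count target)))))

  few : ∀ p r → p + r ≡ n → n ≤ p + p → 2 * r ≤ n
  few p r refl h = +-cancelʳ-≤ (p + p) _ _ (≤-trans (≤-reflexive (lemma p r)) (+-monoʳ-≤ (p + r) h))
    where
    lemma : ∀ p r → 2 * r + (p + p) ≡ (p + r) + (p + r)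
    lemma = solve-∀

  asPath : DPath n → Link n
  asPath (a , as) = path a as

  map-asPath : ∀ (f : Link n → Fin n) (g : DPath n → Fin n) → (∀ q → f (asPath q) ≡ g q) → ∀ qs bs →
    map f (map asPath qs ++ bs) ≡ map g qs ++ map f bs
  map-asPath f g h []       bs = refl
  map-asPath f g h (q ∷ qs) bs = cong₂ _∷_ (h q) (map-asPath f g h qs bs)

  no-breaks : ∀ qs → ∑ isBreak (map asPath qs) ≡ 0
  no-breaks qs = trans (∑-map isBreak asPath qs) (∑-0 (λ _ → refl) qs)

  result : Linkage H
  result with unstarted | unfinished
  ... | rs , p | ts , q with pair-up rs ts (+-cancelˡ-≡ (length paths) _ _ (trans (length-rest p) (sym (length-rest q))))
  ...   | ls , e , f , s , u , b = record
    { links    = map asPath paths ++ ls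
    ; starts   = ↭-trans (↭-reflexive (trans (map-asPath start source (λ _ → refl) paths ls) (cong (map source paths ++_) e))) p
    ; finishes = ↭-trans (↭-reflexive (trans (map-asPath finish target (λ _ → refl) paths ls) (cong (map target paths ++_) f))) q
    ; simple   = Allₚ.++⁺ (Allₚ.map⁺ simple) s
    ; uses-≡   = λ x y → trans (∑-++ (uses x y ∘ vertices) (map asPath paths) ls) (trans (cong₂ _+_
        (trans (∑-map (uses x y ∘ vertices) asPath paths) (trans (uses-≡ x y) (trans (uc x y)
          (trans (uD x y) (edgeCount-edgesOf sH x y))))) (u x y)) (+-identityʳ _))
    ; breaks   = ≤-trans (≤-reflexive (cong (2 *_) (trans (∑-++ isBreak (map asPath paths) ls)
        (trans (cong₂ _+_ (no-breaks paths) b) refl)))) (few (length paths) (length rs) (length-rest p) many) }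

-- Sweeping the copies of a path of `G`

-- One-vertex paths arise throughout the construction and are discarded at its end, so they must not
-- be counted.
nontrivial# : ∀ {A : Set} → List A → ℕ
nontrivial# (_ ∷ _ ∷ _) = 1
nontrivial# _           = 0

nontrivial#≤1 : ∀ {A : Set} (P : List A) → nontrivial# P ≤ 1
nontrivial#≤1 []          = z≤n
nontrivial#≤1 (_ ∷ [])    = z≤n
nontrivial#≤1 (_ ∷ _ ∷ _) = ≤-refl

-- The last vertex counts whatever its flag, since the end layer always receives its links. The
-- first vertex of the path is accounted for in `path-sweep`.
flagged : ∀ {A : Set} → (A → Bool) → (A → ℕ) → A → List A → ℕ
flagged φ f r []       = f r
flagged φ f r (s ∷ ss) = ⟦ φ r ⟧ * f r + flagged φ f s ss

-- The n copies of a path of G are followed simultaneously.  At a flagged vertex q the n paths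
-- met so far are continued along the links of the copy of H at q: a path link extends the
-- path that arrives at its start, a break ends one path and begins another.
module Sweep {m n : ℕ} {H : Adj n} (L : Linkage H) where
  open Linkage L

  V : Set
  V = Fin (m * n)

  vtx : Fin m → Fin n → V
  vtx = combine

  δ-vtx : ∀ a b c d → δ (vtx a b) (vtx c d) ≡ δ a c * δ b d
  δ-vtx a b c d with a ≟ c | b ≟ d
  ... | yes refl | yes refl = δ-refl (vtx a b)
  ... | yes refl | no b≢d   = δ-≢ (λ e → b≢d (proj₂ (combine-injective a b c d e)))
  ... | no a≢c   | _        = δ-≢ (λ e → a≢c (proj₁ (combine-injective a b c d e)))

  edge-vtx : ∀ a b c d q x r y → edge (vtx a b) (vtx c d) (vtx q x) (vtx r y)
    ≡ (δ q a * δ r c) * (δ x b * δ y d) + (δ q c * δ r a) * (δ x d * δ y b)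
  edge-vtx a b c d q x r y rewrite δ-vtx q x a b | δ-vtx r y c d | δ-vtx q x c d | δ-vtx r y a b
    = lemma (δ q a) (δ x b) (δ r c) (δ y d) (δ q c) (δ x d) (δ r a) (δ y b)
    where
    lemma : ∀ x₁ x₂ x₃ x₄ y₁ y₂ y₃ y₄ → (x₁ * x₂) * (x₃ * x₄) + (y₁ * y₂) * (y₃ * y₄)
      ≡ (x₁ * x₃) * (x₂ * x₄) + (y₁ * y₃) * (y₂ * y₄)
    lemma = solve-∀

  walk-copy : ∀ a b c d q x xs →
    walk (vtx a b) (vtx c d) (vtx q x) (map (vtx q) xs) ≡ (δ a q * δ c q) * walk b d x xs
  walk-copy a b c d q x []       = sym (*-zeroʳ (δ a q * δ c q))
  walk-copy a b c d q x (y ∷ ys) = trans (cong₂ _+_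
      (trans (edge-vtx a b c d q x q y)
        (trans (cong₂ _+_ (cong (_* (δ x b * δ y d)) (cong₂ _*_ (δ-sym q a) (δ-sym q c)))
                          (cong (_* (δ x d * δ y b)) (cong₂ _*_ (δ-sym q c) (δ-sym q a))))
               (lemma (δ a q) (δ c q) (δ x b * δ y d) (δ x d * δ y b))))
      (walk-copy a b c d q y ys)) (sym (*-distribˡ-+ (δ a q * δ c q) (edge b d x y) _))
    where
    lemma : ∀ s t x y → (s * t) * x + (t * s) * y ≡ (s * t) * (x + y)
    lemma = solve-∀

  uses-copy : ∀ a b c d q P → uses (vtx a b) (vtx c d) (map (vtx q) P) ≡ (δ a q * δ c q) * uses b d P
  uses-copy a b c d q []      = sym (*-zeroʳ (δ a q * δ c q))
  uses-copy a b c d q (x ∷ P) = walk-copy a b c d q x P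

  occ-copy : ∀ r h q P → occ (vtx r h) (map (vtx q) P) ≡ δ r q * occ h P
  occ-copy r h q P = trans (∑-map (δ (vtx r h)) (vtx q) P)
    (trans (∑-cong (λ x → δ-vtx r h q x) P) (∑-*ˡ (δ r q) (δ h) P))

  -- A path under construction, without its current end vertex vtx q h: the layer q is left implicit.
  Open : Set
  Open = Fin n × List V

  at : Fin m → Open → List V
  at q (h , o) = vtx q h ∷ o

  Clear : Fin m → List V → Set
  Clear r P = ∀ h → occ (vtx r h) P ≡ 0

  -- `R` holds the layers still ahead. `Arriving` adds that only the tip lies in layer `q`, so a
  -- link starting at the tip meets no other vertex of the path.
  Valid : Fin m → List (Fin m) → Open → Set
  Valid q R p = Simple (at q p) × (∀ {r} → r ∈ R → Clear r (at q p))

  Arriving : Fin m → List (Fin m) → Open → Set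
  Arriving q R p = Valid q R p × Clear q (proj₂ p)

  follow : Fin m → Fin n → List (Fin n) → List V → List V
  follow q a []       o = o
  follow q a (b ∷ bs) o = follow q b bs (vtx q a ∷ o)

  uses-follow : ∀ u v q a as o → uses u v (vtx q (last a as) ∷ follow q a as o)
    ≡ uses u v (vtx q a ∷ o) + uses u v (map (vtx q) (a ∷ as))
  uses-follow u v q a []       o = sym (+-identityʳ _)
  uses-follow u v q a (b ∷ bs) o = trans (uses-follow u v q b bs (vtx q a ∷ o))
    (trans (cong (λ e → e + walk u v (vtx q a) o + walk u v (vtx q b) (map (vtx q) bs)) (edge-comm u v (vtx q b) (vtx q a)))
      (lemma (edge u v (vtx q a) (vtx q b)) (walk u v (vtx q a) o) _))
    where
    lemma : ∀ x y z → (x + y) + z ≡ y + (x + z)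
    lemma = solve-∀

  occ-follow : ∀ z q a as o → occ z (vtx q (last a as) ∷ follow q a as o)
    ≡ occ z (map (vtx q) (a ∷ as)) + occ z o
  occ-follow z q a []       o = cong (_+ occ z o) (sym (+-identityʳ (δ z (vtx q a))))
  occ-follow z q a (b ∷ bs) o = trans (occ-follow z q b bs (vtx q a ∷ o))
    (lemma (occ z (map (vtx q) (b ∷ bs))) (δ z (vtx q a)) (occ z o))
    where
    lemma : ∀ x y z → x + (y + z) ≡ (y + x) + z
    lemma = solve-∀

  simple-vtx : ∀ P → (∀ r h → occ (vtx r h) P ≤ 1) → Simple P
  simple-vtx P s z = subst (λ z → occ z P ≤ 1) (combine-remQuot {m} n z)
                         (s (proj₁ (remQuot {m} n z)) (proj₂ (remQuot {m} n z)))

  follow-valid : ∀ {q R} a as o → q ∉ R → Simple (a ∷ as) → Arriving q R (a , o)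
    → Valid q R (last a as , follow q a as o)
  follow-valid {q} {R} a as o q∉R s ((s′ , cl) , cl-q) = simple-vtx (vtx q (last a as) ∷ follow q a as o) bound , λ {r} r∈ h → trans (occ-eq r h)
      (cong₂ _+_ (trans (occ-copy r h q (a ∷ as)) (cong (_* occ h (a ∷ as)) (δ-≢ {x = r} {q} λ { refl → q∉R r∈ })))
                 (m+n≡0⇒n≡0 (δ (vtx r h) (vtx q a)) (cl r∈ h)))
    where
    occ-eq : ∀ r h → occ (vtx r h) (vtx q (last a as) ∷ follow q a as o)
      ≡ occ (vtx r h) (map (vtx q) (a ∷ as)) + occ (vtx r h) o
    occ-eq r h = occ-follow (vtx r h) q a as o
    bound : ∀ r h → occ (vtx r h) (vtx q (last a as) ∷ follow q a as o) ≤ 1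
    bound r h with r ≟ q
    ... | yes refl = ≤-trans (≤-reflexive (trans (occ-eq r h) (trans (cong₂ _+_ (occ-copy r h q (a ∷ as)) (cl-q h))
                       (trans (+-identityʳ _) (trans (cong (_* occ h (a ∷ as)) (δ-refl r)) (*-identityˡ _)))))) (s h)
    ... | no r≢q   = ≤-trans (≤-reflexive (trans (occ-eq r h) (cong (_+ occ (vtx r h) o)
                       (trans (occ-copy r h q (a ∷ as)) (cong (_* occ h (a ∷ as)) (δ-≢ {x = r} {q} r≢q))))))
                       (≤-trans (m≤n+m _ _) (s′ (vtx r h)))

  fresh-valid : ∀ {q R} h → q ∉ R → Valid q R (h , [])
  fresh-valid {q} h q∉R = (λ z → ≤-trans (≤-reflexive (+-identityʳ _)) (δ-≤1 z (vtx q h)))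
    , λ {r} r∈ h′ → trans (+-identityʳ _) (trans (δ-vtx r h′ q h) (cong (_* δ h′ h) (δ-≢ {x = r} {q} λ { refl → q∉R r∈ })))

  -- The three bounds serve three positions of the layer: `closed≤breaks` an inner one,
  -- `closed≤opened` the first, where the incoming paths are single vertices, and `≤length` the
  -- last, after which all open paths are collected.
  record Linked (q : Fin m) (R : List (Fin m)) (ls : List (Link n)) (O : List Open) : Set where
    field
      opens   : List Open
      closed  : List (List V)
      tips    : map proj₁ opens ≡ map finish ls
      valid   : All (Valid q R) opens
      closed-simple : All Simple closed
      usage   : ∀ u v → ∑ (uses u v) closed + ∑ (uses u v ∘ at q) opens
                      ≡ ∑ (uses u v ∘ at q) O + ∑ (λ l → uses u v (map (vtx q) (vertices l))) ls
      closed≤breaks : ∑ nontrivial# closed ≤ ∑ isBreak ls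
      closed≤opened : ∑ nontrivial# closed ≤ ∑ (nontrivial# ∘ at q) O
      ≤length       : ∑ nontrivial# closed + ∑ (nontrivial# ∘ at q) opens ≤ length O

  link : ∀ q R ls O → q ∉ R → map start ls ≡ map proj₁ O → All (Simple ∘ vertices) ls
    → All (Arriving q R) O → Linked q R ls O
  link q R [] [] q∉ eq [] [] = record
    { opens = [] ; closed = [] ; tips = refl ; valid = [] ; closed-simple = [] ; usage = λ _ _ → refl
    ; closed≤breaks = z≤n ; closed≤opened = z≤n ; ≤length = z≤n }
  link q R (path a as ∷ ls) ((h , o) ∷ O) q∉ eq (s ∷ ss) (v ∷ vs) with refl ← ∷-injectiveˡ eq = record
    { opens = (last a as , follow q a as o) ∷ opens ; closed = closed
    ; tips = cong (_ ∷_) tips ; valid = follow-valid a as o q∉ s v ∷ valid ; closed-simple = closed-simple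
    ; usage = λ x y → trans (cong (λ e → ∑ (uses x y) closed + (e + _)) (uses-follow x y q a as o))
        (trans (lemma₁ (∑ (uses x y) closed) (uses x y (vtx q a ∷ o)) _ _)
          (trans (cong (_+ (uses x y (vtx q a ∷ o) + uses x y (map (vtx q) (a ∷ as)))) (usage x y))
            (lemma₂ (∑ (uses x y ∘ at q) O) _ (uses x y (vtx q a ∷ o)) (uses x y (map (vtx q) (a ∷ as))))))
    ; closed≤breaks = closed≤breaks
    ; closed≤opened = ≤-trans closed≤opened (m≤n+m _ _)
    ; ≤length = ≤-trans (≤-reflexive (lemma₃ (∑ nontrivial# closed) (nontrivial# (at q (last a as , follow q a as o))) _))
        (+-mono-≤ (nontrivial#≤1 (at q (last a as , follow q a as o))) ≤length) }
    where
    open Linked (link q R ls O q∉ (∷-injectiveʳ eq) ss vs)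
    lemma₁ : ∀ c x y o → c + ((x + y) + o) ≡ (c + o) + (x + y)
    lemma₁ = solve-∀
    lemma₂ : ∀ o l x y → (o + l) + (x + y) ≡ (x + o) + (y + l)
    lemma₂ = solve-∀
    lemma₃ : ∀ x y z → x + (y + z) ≡ y + (x + z)
    lemma₃ = solve-∀
  link q R (break a b ∷ ls) ((h , o) ∷ O) q∉ eq (s ∷ ss) (v ∷ vs) with refl ← ∷-injectiveˡ eq = record
    { opens = (b , []) ∷ opens ; closed = (vtx q a ∷ o) ∷ closed
    ; tips = cong (b ∷_) tips ; valid = fresh-valid b q∉ ∷ valid ; closed-simple = proj₁ (proj₁ v) ∷ closed-simple
    ; usage = λ x y → trans (+-assoc (uses x y (vtx q a ∷ o)) _ _)
        (trans (cong (uses x y (vtx q a ∷ o) +_) (usage x y)) (sym (+-assoc (uses x y (vtx q a ∷ o)) _ _)))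
    ; closed≤breaks = +-mono-≤ (nontrivial#≤1 (vtx q a ∷ o)) closed≤breaks
    ; closed≤opened = +-monoʳ-≤ (nontrivial# (vtx q a ∷ o)) closed≤opened
    -- The path begun by a break is still a single vertex, so the break accounts only for the path
    -- it closes.
    ; ≤length = ≤-trans (≤-reflexive (+-assoc (nontrivial# (vtx q a ∷ o)) _ _))
        (+-mono-≤ (nontrivial#≤1 (vtx q a ∷ o)) ≤length) }
    where
    open Linked (link q R ls O q∉ (∷-injectiveʳ eq) ss vs)

  copyUses : Fin m → Fin n → Fin m → Fin n → Fin m → ℕ
  copyUses a b c d q = (δ a q * δ c q) * ⟦ H b d ⟧

  record LinkedAt (q : Fin m) (R : List (Fin m)) (O : List Open) : Set where
    field
      opens   : List Open
      closed  : List (List V)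
      tips    : map proj₁ opens ↭ allFin n
      valid   : All (Valid q R) opens
      closed-simple : All Simple closed
      usage   : ∀ a b c d → ∑ (uses (vtx a b) (vtx c d)) closed + ∑ (uses (vtx a b) (vtx c d) ∘ at q) opens
                          ≡ ∑ (uses (vtx a b) (vtx c d) ∘ at q) O + copyUses a b c d q
      closed≤half   : 2 * ∑ nontrivial# closed ≤ n
      closed≤opened : ∑ nontrivial# closed ≤ ∑ (nontrivial# ∘ at q) O
      ≤n            : ∑ nontrivial# closed + ∑ (nontrivial# ∘ at q) opens ≤ n

  -- The tips of `O` and the starts of the links list the same vertices in different orders;
  -- permuting the links makes them match entry by entry.
  link-at : ∀ q R O → q ∉ R → map proj₁ O ↭ allFin n → All (Arriving q R) O → LinkedAt q R O
  link-at q R O q∉ tipsO arr with ↭-map-inv start (↭-trans starts (↭-sym tipsO))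
  ... | ls , eq , p = record
    { opens = opens ; closed = closed
    ; tips = ↭-trans (↭-reflexive tips) (↭-trans (map⁺ finish (↭-sym p)) finishes)
    ; valid = valid ; closed-simple = closed-simple
    ; usage = λ a b c d → trans (usage (vtx a b) (vtx c d)) (cong (∑ (uses (vtx a b) (vtx c d) ∘ at q) O +_)
        (trans (∑-cong (λ l → uses-copy a b c d q (vertices l)) ls)
        (trans (∑-*ˡ (δ a q * δ c q) (λ l → uses b d (vertices l)) ls)
          (cong ((δ a q * δ c q) *_) (trans (sym (∑-↭ (uses b d ∘ vertices) p)) (uses-≡ b d))))))
    ; closed≤half = ≤-trans (*-monoʳ-≤ 2 (≤-trans closed≤breaks (≤-reflexive (sym (∑-↭ isBreak p))))) breaks
    ; closed≤opened = closed≤opened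
    ; ≤n = ≤-trans ≤length (≤-reflexive (trans (sym (length-map proj₁ O)) (trans (↭-length tipsO) (length-tabulate id)))) }
    where
    open Linked (link q R ls O q∉ (sym eq) (All-resp-↭ p simple) arr)

  advance : Fin m → Open → Open
  advance q (h , o) = h , vtx q h ∷ o

  tips-advance : ∀ q O → map proj₁ (map (advance q) O) ≡ map proj₁ O
  tips-advance q []      = refl
  tips-advance q (p ∷ O) = cong (proj₁ p ∷_) (tips-advance q O)

  advance-arriving : ∀ {q r R} O → r ∉ R → All (Valid q (r ∷ R)) O → All (Arriving r R) (map (advance q) O)
  advance-arriving []            r∉ []             = []
  advance-arriving {q} {r} {R} ((h , o) ∷ O) r∉ ((s , cl) ∷ vs) =
    ((simple-vtx (vtx r h ∷ vtx q h ∷ o) bound , λ {r′} r′∈ h′ → cong₂ _+_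
        (trans (δ-vtx r′ h′ r h) (cong (_* δ h′ h) (δ-≢ {x = r′} {r} λ { refl → r∉ r′∈ }))) (cl (there r′∈) h′))
      , cl (here refl)) ∷ advance-arriving O r∉ vs
    where
    bound : ∀ a b → occ (vtx a b) (vtx r h ∷ vtx q h ∷ o) ≤ 1
    bound a b with a ≟ r
    ... | yes refl = ≤-trans (≤-reflexive (trans (cong (δ (vtx a b) (vtx r h) +_) (cl (here refl) b)) (+-identityʳ _)))
                             (δ-≤1 (vtx a b) (vtx r h))
    ... | no a≢r   = ≤-trans (≤-reflexive (cong (_+ occ (vtx a b) (vtx q h ∷ o))
                       (trans (δ-vtx a b r h) (cong (_* δ b h) (δ-≢ {x = a} {r} a≢r))))) (s (vtx a b))

  -- The tips exhaust the vertices of `H`, so each copy of the edge `q r` is traversed by exactly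
  -- one open path.
  advance-uses : ∀ a b c d q r O → map proj₁ O ↭ allFin n →
    ∑ (uses (vtx a b) (vtx c d) ∘ at r) (map (advance q) O)
      ≡ ∑ (uses (vtx a b) (vtx c d) ∘ at q) O + δ b d * edge a c q r
  advance-uses a b c d q r O tipsO = begin
    ∑ (uses u v ∘ at r) (map (advance q) O)
      ≡⟨ ∑-map (uses u v ∘ at r) (advance q) O ⟩
    ∑ (λ p → edge u v (vtx r (proj₁ p)) (vtx q (proj₁ p)) + uses u v (at q p)) O
      ≡⟨ ∑-+ (λ p → edge u v (vtx r (proj₁ p)) (vtx q (proj₁ p))) (uses u v ∘ at q) O ⟩
    ∑ (λ p → rung (proj₁ p)) O + ∑ (uses u v ∘ at q) O
      ≡⟨ +-comm (∑ (λ p → rung (proj₁ p)) O) _ ⟩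
    ∑ (uses u v ∘ at q) O + ∑ (λ p → rung (proj₁ p)) O
      ≡⟨ cong (∑ (uses u v ∘ at q) O +_) (trans (sym (∑-map rung proj₁ O)) (trans (∑-↭ rung tipsO)
           (trans (∑-cong rung-≡ (allFin n)) (∑δ b (λ h → δ h d * edge a c q r))))) ⟩
    ∑ (uses u v ∘ at q) O + δ b d * edge a c q r ∎
    where
    open ≡-Reasoning
    u v : V
    u = vtx a b
    v = vtx c d
    rung : Fin n → ℕ
    rung h = edge u v (vtx r h) (vtx q h)
    lemma : ∀ w x y z s t → (w * x) * (s * t) + (y * z) * (t * s) ≡ s * (t * (z * y + x * w))
    lemma = solve-∀
    rung-≡ : ∀ h → rung h ≡ δ b h * (δ h d * edge a c q r)
    rung-≡ h = trans (edge-vtx a b c d r h q h)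
      (trans (lemma (δ r a) (δ q c) (δ r c) (δ q a) (δ h b) (δ h d)) (cong (_* (δ h d * edge a c q r)) (δ-sym h b)))

  -- In `few`, each `n` on the right stands for `n / 2` paths; the summand outside `flagged` is the
  -- share of the first vertex of the path of `G`.
  record Swept (φ : Fin m → Bool) (q r : Fin m) (rs : List (Fin m)) (O : List Open) : Set where
    field
      paths  : List (List V)
      paths-simple : All Simple paths
      usage  : ∀ a b c d → ∑ (uses (vtx a b) (vtx c d)) paths
        ≡ ∑ (uses (vtx a b) (vtx c d) ∘ at q) O + δ b d * walk a c q (r ∷ rs)
          + ⟦ H b d ⟧ * flagged φ (λ x → δ a x * δ c x) r rs
      few    : 2 * ∑ nontrivial# paths ≤ n * flagged φ (λ _ → 1) r rs + n

  sweep : ∀ φ q r rs O → AllPairs _≢_ (r ∷ rs) → map proj₁ O ↭ allFin n → All (Valid q (r ∷ rs)) O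
    → Swept φ q r rs O
  sweep φ q r [] O (r≢ ∷ _) tipsO valO = record
    { paths = closed ++ map (at r) opens
    ; paths-simple = Allₚ.++⁺ closed-simple (Allₚ.map⁺ (All.map proj₁ valid))
    ; usage = λ a b c d → trans (∑-++ (uses (vtx a b) (vtx c d)) closed (map (at r) opens))
        (trans (cong (∑ (uses (vtx a b) (vtx c d)) closed +_) (∑-map (uses (vtx a b) (vtx c d)) (at r) opens))
        (trans (usage a b c d) (cong₂ _+_
          (trans (advance-uses a b c d q r O tipsO)
            (cong (λ e → ∑ (uses (vtx a b) (vtx c d) ∘ at q) O + δ b d * e) (sym (+-identityʳ (edge a c q r)))))
          (*-comm (δ a r * δ c r) ⟦ H b d ⟧))))
    -- From the last layer on there are at most `n` paths: half are charged to this vertex, half to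
    -- the first one.
    ; few = ≤-trans (*-monoʳ-≤ 2 (≤-trans (≤-reflexive (trans (∑-++ nontrivial# closed (map (at r) opens))
        (cong (∑ nontrivial# closed +_) (∑-map nontrivial# (at r) opens)))) ≤n)) (≤-reflexive (lemma n)) }
    where
    open LinkedAt (link-at r [] (map (advance q) O) (λ ()) (↭-trans (↭-reflexive (tips-advance q O)) tipsO)
                     (advance-arriving O (λ ()) valO))
    lemma : ∀ n → 2 * n ≡ n * 1 + n
    lemma = solve-∀
  sweep φ q r (s ∷ ss) O (r≢ ∷ distinct) tipsO valO = by-flag (φ r) refl
    where
    r∉ : r ∉ s ∷ ss
    r∉ r∈ = All.lookup r≢ r∈ refl
    tips₁ : map proj₁ (map (advance q) O) ↭ allFin n
    tips₁ = ↭-trans (↭-reflexive (tips-advance q O)) tipsO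
    arr : All (Arriving r (s ∷ ss)) (map (advance q) O)
    arr = advance-arriving O r∉ valO
    by-flag : ∀ b → φ r ≡ b → Swept φ q r (s ∷ ss) O
    by-flag false eq = record
      { paths = paths ; paths-simple = paths-simple
      ; usage = λ a b c d → trans (usage a b c d) (trans
          (cong (λ e → e + δ b d * walk a c r (s ∷ ss) + ⟦ H b d ⟧ * flagged φ (λ x → δ a x * δ c x) s ss)
            (advance-uses a b c d q r O tipsO))
          (trans (lemma (∑ (uses (vtx a b) (vtx c d) ∘ at q) O) (δ b d) (edge a c q r) (walk a c r (s ∷ ss)) _)
            (cong (λ e → ∑ (uses (vtx a b) (vtx c d) ∘ at q) O + δ b d * walk a c q (r ∷ s ∷ ss)
                           + ⟦ H b d ⟧ * (⟦ e ⟧ * (δ a r * δ c r) + flagged φ (λ x → δ a x * δ c x) s ss)) (sym eq))))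
      ; few = ≤-trans few (≤-reflexive (cong (λ e → n * (⟦ e ⟧ * 1 + flagged φ (λ _ → 1) s ss) + n) (sym eq))) }
      where
      open Swept (sweep φ r s ss (map (advance q) O) distinct tips₁ (All.map proj₁ arr))
      lemma : ∀ o d e w f → ((o + d * e) + d * w) + f ≡ (o + d * (e + w)) + f
      lemma = solve-∀
    by-flag true eq = record
      { paths = closed ++ paths ; paths-simple = Allₚ.++⁺ closed-simple paths-simple
      ; usage = λ a b c d → trans (∑-++ (uses (vtx a b) (vtx c d)) closed paths)
          (trans (cong (∑ (uses (vtx a b) (vtx c d)) closed +_) (Swept.usage rest a b c d))
          (trans (lemma₁ (∑ (uses (vtx a b) (vtx c d)) closed) _ (δ b d * walk a c r (s ∷ ss)) _)
          (trans (cong (λ e → e + δ b d * walk a c r (s ∷ ss) + ⟦ H b d ⟧ * flagged φ (λ x → δ a x * δ c x) s ss)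
            (trans (usage a b c d) (cong (_+ copyUses a b c d r) (advance-uses a b c d q r O tipsO))))
          (trans (lemma₂ (∑ (uses (vtx a b) (vtx c d) ∘ at q) O) (δ b d) (edge a c q r) (walk a c r (s ∷ ss))
                         (δ a r * δ c r) ⟦ H b d ⟧ _)
            (cong (λ e → ∑ (uses (vtx a b) (vtx c d) ∘ at q) O + δ b d * walk a c q (r ∷ s ∷ ss)
                           + ⟦ H b d ⟧ * (⟦ e ⟧ * (δ a r * δ c r) + flagged φ (λ x → δ a x * δ c x) s ss)) (sym eq))))))
      ; few = ≤-trans (≤-reflexive (trans (cong (2 *_) (∑-++ nontrivial# closed paths)) (*-distribˡ-+ 2 (∑ nontrivial# closed) _)))
          (≤-trans (+-mono-≤ closed≤half (Swept.few rest))
            (≤-reflexive (trans (lemma₃ n (flagged φ (λ _ → 1) s ss))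
              (cong (λ e → n * (⟦ e ⟧ * 1 + flagged φ (λ _ → 1) s ss) + n) (sym eq))))) }
      where
      open LinkedAt (link-at r (s ∷ ss) (map (advance q) O) r∉ tips₁ arr)
      rest : Swept φ r s ss opens
      rest = sweep φ r s ss opens distinct tips valid
      open Swept rest using (paths; paths-simple)
      lemma₁ : ∀ x o w f → x + ((o + w) + f) ≡ ((x + o) + w) + f
      lemma₁ = solve-∀
      lemma₂ : ∀ o d e w t h f → (((o + d * e) + t * h) + d * w) + h * f ≡ (o + d * (e + w)) + h * (1 * t + f)
      lemma₂ = solve-∀
      lemma₃ : ∀ n f → n + (n * f + n) ≡ n * (1 * 1 + f) + n
      lemma₃ = solve-∀

  record PathSwept (φ : Fin m → Bool) (q r : Fin m) (rs : List (Fin m)) : Set where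
    field
      paths  : List (List V)
      paths-simple : All Simple paths
      usage  : ∀ a b c d → ∑ (uses (vtx a b) (vtx c d)) paths
        ≡ δ b d * walk a c q (r ∷ rs)
          + ⟦ H b d ⟧ * (δ a q * δ c q + flagged φ (λ x → δ a x * δ c x) r rs)
      few    : 2 * ∑ nontrivial# paths ≤ n * (1 + flagged φ (λ _ → 1) r rs)

  path-sweep : ∀ φ q r rs → AllPairs _≢_ (q ∷ r ∷ rs) → PathSwept φ q r rs
  path-sweep φ q r rs (q≢ ∷ distinct) = record
    { paths = closed ++ Swept.paths rest ; paths-simple = Allₚ.++⁺ closed-simple (Swept.paths-simple rest)
    ; usage = λ a b c d → trans (∑-++ (uses (vtx a b) (vtx c d)) closed (Swept.paths rest))
        (trans (cong (∑ (uses (vtx a b) (vtx c d)) closed +_) (Swept.usage rest a b c d))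
        (trans (lemma₁ (∑ (uses (vtx a b) (vtx c d)) closed) _ (δ b d * walk a c q (r ∷ rs)) _)
        (trans (cong (λ e → e + δ b d * walk a c q (r ∷ rs) + ⟦ H b d ⟧ * flagged φ (λ x → δ a x * δ c x) r rs)
            (trans (usage a b c d) (cong (_+ copyUses a b c d q) (initial-0 (uses (vtx a b) (vtx c d)) λ _ → refl))))
          (lemma₂ (δ b d * walk a c q (r ∷ rs)) (δ a q * δ c q) ⟦ H b d ⟧ _))))
    -- In the first layer the breaks close only single vertices, so nothing is added to the count of
    -- the sweep.
    ; few = ≤-trans (≤-reflexive (cong (2 *_) (trans (∑-++ nontrivial# closed (Swept.paths rest))
          (cong (_+ ∑ nontrivial# (Swept.paths rest))
            (n≤0⇒n≡0 (≤-trans closed≤opened (≤-reflexive (initial-0 nontrivial# λ _ → refl))))))))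
        (≤-trans (Swept.few rest) (≤-reflexive (lemma₃ n _))) }
    where
    q∉ : q ∉ r ∷ rs
    q∉ q∈ = All.lookup q≢ q∈ refl
    initial : List Open
    initial = map (_, []) (allFin n)
    initial-0 : ∀ f → (∀ v → f (v ∷ []) ≡ 0) → ∑ (f ∘ at q) initial ≡ 0
    initial-0 f h = trans (∑-map (f ∘ at q) (_, []) (allFin n)) (∑-0 (λ x → h (vtx q x)) (allFin n))
    tips₀ : map proj₁ initial ≡ allFin n
    tips₀ = trans (sym (map-∘ (allFin n))) (map-id (allFin n))
    open LinkedAt (link-at q (r ∷ rs) initial q∉ (↭-reflexive tips₀)
      (Allₚ.map⁺ (All.tabulate λ {h} _ → fresh-valid h q∉ , λ _ → refl)))
    rest : Swept φ q r rs opens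
    rest = sweep φ q r rs opens distinct tips valid
    lemma₁ : ∀ x o w f → x + ((o + w) + f) ≡ ((x + o) + w) + f
    lemma₁ = solve-∀
    lemma₂ : ∀ w t h f → ((0 + t * h) + w) + h * f ≡ w + h * (t + f)
    lemma₂ = solve-∀
    lemma₃ : ∀ n f → n * f + n ≡ n * (1 + f)
    lemma₃ = solve-∀

-- Counts and the predicates of the statement

length-filterᵇ : ∀ (p : A → Bool) xs → length (filterᵇ p xs) ≡ ∑ (⟦_⟧ ∘ p) xs
length-filterᵇ p []       = refl
length-filterᵇ p (x ∷ xs) with p x
... | true  = cong suc (length-filterᵇ p xs)
... | false = length-filterᵇ p xs

⟦⟧-positive : ∀ b → 1 ≤ ⟦ b ⟧ → b ≡ true
⟦⟧-positive true _ = refl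

traverses≡edge : ∀ (u v x y : Fin n) → x ≢ y → ⟦ traverses u v (x , y) ⟧ ≡ edge u v x y
traverses≡edge u v x y x≢y with x ≟ u | y ≟ v | x ≟ v | y ≟ u
... | yes refl | yes refl | yes refl | _        = ⊥-elim (x≢y refl)
... | yes refl | yes refl | no _     | _        = refl
... | yes refl | no _     | _        | yes refl = ⊥-elim (x≢y refl)
... | yes refl | no _     | yes _    | no _     = refl
... | yes refl | no _     | no _     | no _     = refl
... | no _     | yes _    | yes _    | yes _    = refl
... | no _     | yes _    | yes _    | no _     = refl
... | no _     | yes _    | no _     | yes _    = refl
... | no _     | yes _    | no _     | no _     = refl
... | no _     | no _     | yes _    | yes _    = refl
... | no _     | no _     | yes _    | no _     = refl
... | no _     | no _     | no _     | yes _    = refl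
... | no _     | no _     | no _     | no _     = refl

traversals≡uses : ∀ (u v : Fin n) P → AllPairs _≢_ P →
  length (filterᵇ (traverses u v) (steps P)) ≡ uses u v P
traversals≡uses u v P distinct = trans (length-filterᵇ (traverses u v) (steps P)) (go P distinct)
  where
  go : ∀ P → AllPairs _≢_ P → ∑ (⟦_⟧ ∘ traverses u v) (steps P) ≡ uses u v P
  go []           []                   = refl
  go (a ∷ [])     _                    = refl
  go (a ∷ b ∷ bs) ((a≢b ∷ _) ∷ distinct) = cong₂ _+_ (traverses≡edge u v a b a≢b) (go (b ∷ bs) distinct)

edgeUses≡uses : ∀ (u v : Fin n) D → All (AllPairs _≢_) D → edgeUses u v D ≡ ∑ (uses u v) D
edgeUses≡uses u v D distinct = ∑-cong-All (All.map (λ {P} → traversals≡uses u v P) distinct)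

distinct⇒simple : ∀ {P : List (Fin n)} → AllPairs _≢_ P → Simple P
distinct⇒simple []               z = z≤n
distinct⇒simple {P = a ∷ as} (a≢ ∷ distinct) z with z ≟ a
... | no _     = distinct⇒simple distinct z
... | yes refl = s≤s (≤-reflexive (absent as a≢))
  where
  absent : ∀ as → All (z ≢_) as → occ z as ≡ 0
  absent []       []         = refl
  absent (b ∷ bs) (z≢b ∷ ps) = cong₂ _+_ (δ-≢ z≢b) (absent bs ps)

simple⇒distinct : ∀ (P : List (Fin n)) → Simple P → AllPairs _≢_ P
simple⇒distinct []       s = []
simple⇒distinct (a ∷ as) s = All.tabulate fresh ∷ simple⇒distinct as (λ z → ≤-trans (m≤n+m _ _) (s z))
  where
  fresh : ∀ {b} → b ∈ as → a ≢ b
  fresh b∈ refl = 1+n≰n (≤-trans (+-mono-≤ (≤-reflexive (sym (δ-refl a)))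
    (≤-trans (≤-reflexive (sym (δ-refl a))) (∈⇒≤∑ (δ a) b∈))) (s a))

-- Path decompositions of the Cartesian product

-- The disjunction becomes a sum because its alternatives exclude each other: `a = c` rules out an
-- edge `a c` of the irreflexive `G`.
□-indicator : ∀ {G : Adj m} {H : Adj n} → IsSimple G → ∀ a b c d →
  ⟦ (G □ H) (combine a b) (combine c d) ⟧ ≡ δ b d * ⟦ G a c ⟧ + ⟦ H b d ⟧ * δ a c
□-indicator {m} {n} {G} {H} sG a b c d =
  trans (cong ⟦_⟧ (cong₂ adjacent (remQuot-combine {m} {n} a b) (remQuot-combine {m} {n} c d))) indicator
  where
  adjacent : Fin m × Fin n → Fin m × Fin n → Bool
  adjacent (a , b) (c , d) = (G a c ∧ ⌊ b ≟ d ⌋) ∨ (⌊ a ≟ c ⌋ ∧ H b d)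
  indicator : ⟦ adjacent (a , b) (c , d) ⟧ ≡ δ b d * ⟦ G a c ⟧ + ⟦ H b d ⟧ * δ a c
  indicator with b ≟ d | a ≟ c
  ... | yes _ | yes refl rewrite IsSimple.irrefl sG a = sym (*-identityʳ _)
  ... | no _  | yes refl rewrite IsSimple.irrefl sG a = sym (*-identityʳ _)
  ... | yes _ | no _ with G a c
  ...   | true  = cong suc (sym (*-zeroʳ ⟦ H b d ⟧))
  ...   | false = sym (*-zeroʳ ⟦ H b d ⟧)
  indicator | no _ | no _ with G a c
  ...   | true  = sym (*-zeroʳ ⟦ H b d ⟧)
  ...   | false = sym (*-zeroʳ ⟦ H b d ⟧)

trim : ∀ (R : List (List (Fin n))) → ∃ λ R′ → All (λ P → 2 ≤ length P) R′ × (∀ {P} → P ∈ R′ → P ∈ R)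
  × (∀ u v → ∑ (uses u v) R′ ≡ ∑ (uses u v) R) × length R′ ≡ ∑ nontrivial# R
trim []                = [] , [] , (λ ()) , (λ _ _ → refl) , refl
trim ([] ∷ R)          with trim R
... | R′ , l , i , u , e = R′ , l , there ∘ i , u , e
trim ((a ∷ []) ∷ R)    with trim R
... | R′ , l , i , u , e = R′ , l , there ∘ i , u , e
trim ((a ∷ b ∷ P) ∷ R) with trim R
... | R′ , l , i , u , e = (a ∷ b ∷ P) ∷ R′ , s≤s (s≤s z≤n) ∷ l
  , (λ { (here eq) → here eq ; (there p) → there (i p) })
  , (λ x y → cong (uses x y (a ∷ b ∷ P) +_) (u x y)) , cong suc e

uses-steps : ∀ (P : List (Fin n)) → All (λ (x , y) → 1 ≤ uses x y P) (steps P)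
uses-steps []           = []
uses-steps (a ∷ [])     = []
uses-steps (a ∷ b ∷ bs) = ≤-trans (edge-self a b) (m≤m+n _ _) ∷ All.map (λ p → ≤-trans p (m≤n+m _ _)) (uses-steps (b ∷ bs))

-- Adjacency comes from the counts: a step contributes to the uses of its own pair, and an indicator
-- is positive only on edges.
decomposition : ∀ {A : Adj n} R → All Simple R → (∀ u v → ∑ (uses u v) R ≡ ⟦ A u v ⟧) →
  ∃ λ D → IsPathDecomposition A D × length D ≡ ∑ nontrivial# R
decomposition {n} {A} R simple usage with trim R
... | D , long , D⊆R , usageD , len = D , record
    { paths = All.tabulate isPath ; exact = λ u v Auv → trans (edgeUses≡uses u v D distinct)
        (trans (usageD u v) (trans (usage u v) (cong ⟦_⟧ Auv))) } , len
  where
  distinct : All (AllPairs _≢_) D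
  distinct = All.tabulate λ {P} P∈ → simple⇒distinct P (All.lookup simple (D⊆R P∈))
  isPath : ∀ {P} → P ∈ D → IsPath A P
  isPath {P} P∈ = record
    { nontrivial = All.lookup long P∈ ; distinct = All.lookup distinct P∈
    ; adjacent = All.map (λ {(x , y)} p → ⟦⟧-positive (A x y) (≤-trans p (≤-trans (∈⇒≤∑ (uses x y) (D⊆R P∈))
        (≤-reflexive (usage x y))))) (uses-steps P) }

-- Distributing the insertions over the vertices of `G`

isZero : ℕ → Bool
isZero zero    = true
isZero (suc _) = false

∑-over-path : ∀ (g : Fin m → ℕ) P → ∑ (λ v → occ v P * g v) (allFin m) ≡ ∑ g P
∑-over-path {m} g []      = ∑-0 (λ _ → refl) (allFin m)
∑-over-path {m} g (x ∷ P) = trans (∑-cong (λ v → *-distribʳ-+ (g v) (δ v x) (occ v P)) (allFin m))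
  (trans (∑-+ (λ v → δ v x * g v) (λ v → occ v P * g v) (allFin m))
    (cong₂ _+_ (trans (∑-cong (λ v → cong (_* g v) (δ-sym v x)) (allFin m)) (∑δ x g)) (∑-over-path g P)))

∑-over-ends : ∀ (g : Fin m → ℕ) a as → ∑ (λ v → ends v (a ∷ as) * g v) (allFin m) ≡ g a + g (last a as)
∑-over-ends {m} g a as = trans (∑-cong (λ v → cong (λ e → (δ v a + e) * g v) (sym (+-identityʳ (δ v (last a as))))) (allFin m))
  (trans (∑-over-path g (a ∷ last a as ∷ [])) (cong (g a +_) (+-identityʳ _)))

∑-ends : ∀ (P : List (Fin m)) → 2 ≤ length P → ∑ (λ v → ends v P) (allFin m) ≡ 2
∑-ends {m} (a ∷ as) _ = trans (∑-cong (λ v → sym (*-identityʳ (ends v (a ∷ as)))) (allFin m)) (∑-over-ends (λ _ → 1) a as)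

flagged-≡ : ∀ φ (f : Fin m → ℕ) r rs → φ (last r rs) ≡ false →
  flagged φ f r rs ≡ f (last r rs) + ∑ (λ x → ⟦ φ x ⟧ * f x) (r ∷ rs)
flagged-≡ φ f r []       eq rewrite eq = sym (+-identityʳ (f r))
flagged-≡ φ f r (s ∷ ss) eq = trans (cong (⟦ φ r ⟧ * f r +_) (flagged-≡ φ f s ss eq))
  (lemma (⟦ φ r ⟧ * f r) (f (last s ss)) _)
  where
  lemma : ∀ x y z → x + (y + z) ≡ y + (x + z)
  lemma = solve-∀

-- A vertex which is no path end is flagged on the last path of the list through it.
module Flags (inner : Fin m → Bool) where

  flag : List (List (Fin m)) → Fin m → Bool
  flag Qs v = inner v ∧ isZero (∑ (occ v) Qs)

  flags : List (List (Fin m)) → Fin m → ℕ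
  flags []       v = 0
  flags (Q ∷ Qs) v = occ v Q * ⟦ flag Qs v ⟧ + flags Qs v

  -- The second summand is the flag still owed to an inner vertex that no path of `Qs` visits; the
  -- next path through it pays the debt.
  flags-once : ∀ Qs → All Simple Qs → ∀ v → flags Qs v + ⟦ flag Qs v ⟧ ≡ ⟦ inner v ⟧
  flags-once []       []       v with inner v
  ... | true  = refl
  ... | false = refl
  flags-once (Q ∷ Qs) (s ∷ ss) v with occ v Q | s v | flags-once Qs ss v
  ... | zero  | _       | ih = ih
  ... | suc zero | _ | ih with inner v
  ...   | true  = trans (lemma (⟦ true ∧ isZero (∑ (occ v) Qs) ⟧) (flags Qs v)) ih
    where
    lemma : ∀ x y → ((x + 0) + y) + 0 ≡ y + x
    lemma = solve-∀
  ...   | false = trans (+-identityʳ _) (trans (sym (+-identityʳ _)) ih)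
  flags-once (Q ∷ Qs) (s ∷ ss) v | suc (suc _) | s≤s () | ih

  -- How often the links of `H` are inserted in the layer of `v`: both the multiplicity with which
  -- its edges are covered and the number of shares `n / 2` charged to `v`.
  marks : List (List (Fin m)) → Fin m → ℕ
  marks Qs v = ∑ (ends v) Qs + flags Qs v

  -- The function `f` is left open for two uses: an indicator gives the edge counts, the constant 1
  -- the number of paths. The ends of `Q` are not inner, hence not flagged in addition.
  marks-∷ : ∀ (f : Fin m → ℕ) q r rs Qs → (∀ v → 1 ≤ ends v (q ∷ r ∷ rs) → inner v ≡ false) →
    ∑ (λ v → marks ((q ∷ r ∷ rs) ∷ Qs) v * f v) (allFin m)
      ≡ (f q + flagged (flag Qs) f r rs) + ∑ (λ v → marks Qs v * f v) (allFin m)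
  marks-∷ f q r rs Qs outer = begin
    ∑ (λ v → marks (Q ∷ Qs) v * f v) V
      ≡⟨ ∑-cong (λ v → lemma (ends v Q) (∑ (ends v) Qs) (occ v Q) ⟦ flag Qs v ⟧ (flags Qs v) (f v)) V ⟩
    ∑ (λ v → (ends v Q * f v + occ v Q * (⟦ flag Qs v ⟧ * f v)) + marks Qs v * f v) V
      ≡⟨ ∑-+ (λ v → ends v Q * f v + occ v Q * (⟦ flag Qs v ⟧ * f v)) (λ v → marks Qs v * f v) V ⟩
    ∑ (λ v → ends v Q * f v + occ v Q * (⟦ flag Qs v ⟧ * f v)) V + ∑ (λ v → marks Qs v * f v) V
      ≡⟨ cong (_+ ∑ (λ v → marks Qs v * f v) V) (trans (∑-+ (λ v → ends v Q * f v) (λ v → occ v Q * (⟦ flag Qs v ⟧ * f v)) V)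
           (trans (cong₂ _+_ (∑-over-ends f q (r ∷ rs)) (∑-over-path (λ v → ⟦ flag Qs v ⟧ * f v) Q))
                  (trans (cong (λ e → (f q + f (last r rs)) + (⟦ e ⟧ * f q + ∑ (λ x → ⟦ flag Qs x ⟧ * f x) (r ∷ rs))) unflagged-q)
                  (trans (+-assoc (f q) _ _) (cong (f q +_) (sym (flagged-≡ (flag Qs) f r rs unflagged-last))))))) ⟩
    (f q + flagged (flag Qs) f r rs) + ∑ (λ v → marks Qs v * f v) V ∎
    where
    open ≡-Reasoning
    V : List (Fin m)
    V = allFin m
    Q : List (Fin m)
    Q = q ∷ r ∷ rs
    lemma : ∀ e E o φ F f → ((e + E) + (o * φ + F)) * f ≡ (e * f + o * (φ * f)) + (E + F) * f
    lemma = solve-∀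
    unflagged : ∀ v → 1 ≤ ends v Q → flag Qs v ≡ false
    unflagged v p = cong (_∧ isZero (∑ (occ v) Qs)) (outer v p)
    unflagged-q : flag Qs q ≡ false
    unflagged-q = unflagged q (≤-trans (≤-reflexive (sym (δ-refl q))) (m≤m+n _ _))
    unflagged-last : flag Qs (last r rs) ≡ false
    unflagged-last = unflagged (last r rs) (≤-trans (≤-reflexive (sym (δ-refl (last r rs)))) (m≤n+m _ _))

  record ProductPaths (H : Adj n) (Qs : List (List (Fin m))) : Set where
    field
      paths  : List (List (Fin (m * n)))
      paths-simple : All Simple paths
      usage  : ∀ a b c d → ∑ (uses (combine a b) (combine c d)) paths
        ≡ δ b d * ∑ (uses a c) Qs + ⟦ H b d ⟧ * ∑ (λ v → marks Qs v * (δ a v * δ c v)) (allFin m)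
      few    : 2 * ∑ nontrivial# paths ≤ n * ∑ (λ v → marks Qs v * 1) (allFin m)

  product-paths : ∀ {H : Adj n} → Linkage H → ∀ Qs → All (λ Q → 2 ≤ length Q) Qs → All (AllPairs _≢_) Qs
    → All (λ Q → ∀ v → 1 ≤ ends v Q → inner v ≡ false) Qs → ProductPaths H Qs
  product-paths {n} {H} L [] _ _ _ = record
    { paths = [] ; paths-simple = []
    ; usage = λ a b c d → sym (cong₂ _+_ (*-zeroʳ (δ b d))
        (trans (cong (⟦ H b d ⟧ *_) (∑-0 (λ _ → refl) (allFin m))) (*-zeroʳ ⟦ H b d ⟧)))
    ; few = z≤n }
  product-paths {n} {H} L ((q ∷ r ∷ rs) ∷ Qs) (_ ∷ long) (distinct ∷ distincts) (outer ∷ outers) = record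
    { paths = Swp.paths ++ Rest.paths ; paths-simple = Allₚ.++⁺ Swp.paths-simple Rest.paths-simple
    ; usage = λ a b c d → trans (∑-++ (uses (combine a b) (combine c d)) Swp.paths Rest.paths)
        (trans (cong₂ _+_ (Swp.usage a b c d) (Rest.usage a b c d))
        (trans (lemma₁ (δ b d) (walk a c q (r ∷ rs)) ⟦ H b d ⟧ _ (∑ (uses a c) Qs) _)
          (cong (λ e → δ b d * ∑ (uses a c) ((q ∷ r ∷ rs) ∷ Qs) + ⟦ H b d ⟧ * e)
            (sym (marks-∷ (λ v → δ a v * δ c v) q r rs Qs outer)))))
    ; few = ≤-trans (≤-reflexive (trans (cong (2 *_) (∑-++ nontrivial# Swp.paths Rest.paths)) (*-distribˡ-+ 2 (∑ nontrivial# Swp.paths) _)))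
        (≤-trans (+-mono-≤ Swp.few Rest.few)
          (≤-reflexive (trans (sym (*-distribˡ-+ n _ _)) (cong (n *_) (sym (marks-∷ (λ _ → 1) q r rs Qs outer)))))) }
    where
    module Swp  = Sweep.PathSwept (Sweep.path-sweep L (flag Qs) q r rs distinct)
    module Rest = ProductPaths (product-paths L Qs long distincts outers)
    lemma₁ : ∀ d w h f W F → (d * w + h * f) + (d * W + h * F) ≡ d * (w + W) + h * (f + F)
    lemma₁ = solve-∀
  product-paths L ([] ∷ Qs)       (() ∷ _)
  product-paths L ((_ ∷ []) ∷ Qs) (s≤s () ∷ _)

-- Parity of the path ends in `G`

module Ends {G : Adj m} (sG : IsSimple G) {D : List (List (Fin m))} (dec : IsPathDecomposition G D) where
  open IsPathDecomposition dec

  long : All (λ Q → 2 ≤ length Q) D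
  long = All.map IsPath.nontrivial paths

  distinct : All (AllPairs _≢_) D
  distinct = All.map IsPath.distinct paths

  used-adjacent : ∀ u v P → All (λ e → G (proj₁ e) (proj₂ e) ≡ true) (steps P) → 1 ≤ uses u v P → G u v ≡ true
  used-adjacent u v (a ∷ b ∷ bs) (Gab ∷ adj) p with +-positive (edge u v a b) _ p
  ... | inj₂ q = used-adjacent u v (b ∷ bs) adj q
  ... | inj₁ q with a ≟ u | b ≟ v | a ≟ v | b ≟ u
  ...   | yes refl | yes refl | _        | _        = Gab
  ...   | _        | _        | yes refl | yes refl = trans (IsSimple.symm sG u v) Gab
  ...   | yes _    | no _     | yes _    | no _     = ⊥-elim (1+n≰n q)
  ...   | yes _    | no _     | no _     | _        = ⊥-elim (1+n≰n q)
  ...   | no _     | _        | yes _    | no _     = ⊥-elim (1+n≰n q)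
  ...   | no _     | _        | no _     | _        = ⊥-elim (1+n≰n q)

  -- `exact` fixes the count on edges only; elsewhere it vanishes because the steps of a path are
  -- edges.
  usage : ∀ u v → ∑ (uses u v) D ≡ ⟦ G u v ⟧
  usage u v with G u v in Guv
  ... | true  = trans (sym (edgeUses≡uses u v D distinct)) (exact u v Guv)
  ... | false with ∑ (uses u v) D in eq
  ...   | zero  = refl
  ...   | suc _ with ∑-positive (uses u v) D (subst (1 ≤_) (sym eq) (s≤s z≤n))
  ...     | P , P∈ , q with trans (sym Guv) (used-adjacent u v P (IsPath.adjacent (All.lookup paths P∈)) q)
  ...       | ()

  -- Each occurrence of `v` has two sides, and each side is an edge of the path or an end of it.
  handshake : ∀ v (P : List (Fin m)) → ∑ (λ u → uses v u P) (allFin m) + ends v P ≡ 2 * occ v P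
  handshake v []       = trans (+-identityʳ _) (∑-0 (λ _ → refl) (allFin m))
  handshake v (a ∷ as) = go a as
    where
    edge-total : ∀ a b → ∑ (λ u → edge v u a b) (allFin m) ≡ δ v a + δ v b
    edge-total a b = trans (∑-+ (λ u → δ a v * δ b u) (λ u → δ a u * δ b v) (allFin m)) (cong₂ _+_
      (trans (∑-*ˡ (δ a v) (δ b) (allFin m)) (trans (cong (δ a v *_) (∑δ-one b)) (trans (*-identityʳ _) (δ-sym a v))))
      (trans (∑δ a (λ _ → δ b v)) (δ-sym b v)))
    lemma : ∀ x y w l → ((x + y) + w) + (x + l) ≡ (x + x) + (w + (y + l))
    lemma = solve-∀
    lemma₂ : ∀ x o → (x + x) + 2 * o ≡ 2 * (x + o)
    lemma₂ = solve-∀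
    go : ∀ a as → ∑ (λ u → walk v u a as) (allFin m) + (δ v a + δ v (last a as)) ≡ 2 * occ v (a ∷ as)
    go a []       = trans (cong (_+ (δ v a + δ v a)) (∑-0 (λ _ → refl) (allFin m))) (trans (sym (+-identityʳ _)) (lemma₂ (δ v a) 0))
    go a (b ∷ bs) = trans (cong (_+ (δ v a + δ v (last b bs)))
        (trans (∑-+ (λ u → edge v u a b) (λ u → walk v u b bs) (allFin m)) (cong (_+ ∑ (λ u → walk v u b bs) (allFin m)) (edge-total a b))))
      (trans (lemma (δ v a) (δ v b) (∑ (λ u → walk v u b bs) (allFin m)) (δ v (last b bs)))
        (trans (cong ((δ v a + δ v a) +_) (go b bs)) (lemma₂ (δ v a) (occ v (b ∷ bs)))))

  degree-parity : ∀ v → degree G v + ∑ (ends v) D ≡ 2 * ∑ (occ v) D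
  degree-parity v = trans (cong (_+ ∑ (ends v) D)
      (trans (length-filterᵇ (G v) (allFin m)) (trans (∑-cong (λ u → sym (usage v u)) (allFin m))
        (∑-swap (λ u P → uses v u P) (allFin m) D))))
    (trans (sym (∑-+ (λ P → ∑ (λ u → uses v u P) (allFin m)) (ends v) D))
      (trans (∑-cong (handshake v) D) (∑-*ˡ 2 (occ v) D)))

  -- If no path ends at `v`, then `degree-parity` makes its degree twice a number.
  odd≤ends : ∀ v → ⟦ isOdd (degree G v) ⟧ ≤ ∑ (ends v) D
  odd≤ends v with ∑ (ends v) D in eq
  ... | suc _ = ≤-trans (⟦⟧≤1 _) (s≤s z≤n)
  ... | zero  = ≤-reflexive (cong ⟦_⟧ (trans (cong isOdd even) (cong (_≡ᵇ 1) (m*n%n≡0 (∑ (occ v) D) 2))))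
    where
    even : degree G v ≡ ∑ (occ v) D * 2
    even = trans (sym (+-identityʳ _)) (trans (cong (degree G v +_) (sym eq)) (trans (degree-parity v) (*-comm 2 (∑ (occ v) D))))

  ends-total : ∑ (λ v → ∑ (ends v) D) (allFin m) ≡ 2 * length D
  ends-total = trans (∑-swap ends (allFin m) D) (trans (∑-cong-All (All.map (λ {P} → ∑-ends P) long))
    (trans (∑-*ˡ 2 (λ _ → 1) D) (cong (2 *_) (∑-1 D))))

  -- There are `2 * length D` ends in all, as many as odd vertices, so the bound `odd≤ends` is
  -- attained at every vertex.
  ends≤1 : 2 * length D ≡ nOdd G → ∀ v → ∑ (ends v) D ≤ 1
  ends≤1 eq v = ≤-trans (≤-reflexive (sym (∑-≡⇒pointwise odd≤ends (allFin m)
    (trans (sym (length-filterᵇ (λ u → isOdd (degree G u)) (allFin m))) (trans (sym eq) (sym ends-total))) (∈-allFin v))))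
    (⟦⟧≤1 (isOdd (degree G v)))

  neighbour : Connected G → 2 ≤ m → ∀ v → ∃ λ w → G v w ≡ true
  neighbour conn (s≤s (s≤s z≤n)) v with other v
    where
    other : ∀ {k} (v : Fin (suc (suc k))) → ∃ λ w → v ≢ w
    other zero    = suc zero , λ ()
    other (suc v) = zero , λ ()
  ... | w , v≢w with conn v w
  ...   | here              = ⊥-elim (v≢w refl)
  ...   | step {w = w′} e _ = w′ , e

  -- A vertex on no path would have degree 0, but a connected graph of order at least 2 has no
  -- isolated vertex. Coverage is what guarantees every even vertex its flag.
  covered : Connected G → 2 ≤ m → ∀ v → 1 ≤ ∑ (occ v) D
  covered conn 2≤m v with ∑ (occ v) D in eq | neighbour conn 2≤m v
  ... | suc _ | _     = s≤s z≤n
  ... | zero  | w , e = ⊥-elim (1+n≰n (≤-trans (≤-reflexive (sym (cong ⟦_⟧ e)))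
      (≤-trans (∈⇒≤∑ (⟦_⟧ ∘ G v) (∈-allFin w)) (≤-trans (≤-reflexive (sym (length-filterᵇ (G v) (allFin m))))
      (≤-trans (m≤m+n _ _) (≤-reflexive (trans (degree-parity v) (cong (2 *_) eq))))))))

theorem4p2 : (m n : ℕ) → 2 ≤ m → (G : Adj m) → (H : Adj n)
    → IsSimple G → IsSimple H → Connected G → Connected H
    → (k : ℕ) → IsPathNumber G k → 2 * k ≡ nOdd G
    → Σ (List (List (Fin (m * n))))
    (λ D → IsPathDecomposition (G □ H) D × 2 * length D ≤ m * n)
theorem4p2 m n 2≤m G H sG sH connG _ k ((D , dec , refl) , _) 2k≡nOdd =
  let D′ , dec′ , len = decomposition P.paths P.paths-simple indicator
  in D′ , dec′ , ≤-trans (≤-reflexive (cong (2 *_) len)) (≤-trans P.few (≤-reflexive (trans (cong (n *_) size) (*-comm n m))))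
  where
  open Ends sG dec
  isInner : Fin m → Bool
  isInner v = isZero (∑ (ends v) D)
  open Flags isInner
  outer : ∀ {Q} → Q ∈ D → ∀ v → 1 ≤ ends v Q → isInner v ≡ false
  outer Q∈ v p with ∑ (ends v) D | ≤-trans p (∈⇒≤∑ (ends v) Q∈)
  ... | suc _ | _ = refl
  module P = ProductPaths (product-paths (linkage sH) D long distinct (All.tabulate outer))
  -- A vertex with a path end has exactly one and no flag; any other lies on some path and is
  -- flagged exactly once. So each copy of `H` is covered once, and the shares `n / 2` number `m`.
  marks-one : ∀ v → marks D v ≡ 1
  marks-one v with ∑ (ends v) D | ends≤1 2k≡nOdd v | ∑ (occ v) D | covered connG 2≤m v
    | flags-once D (All.map distinct⇒simple distinct) v
  ... | zero     | _      | suc _ | _ | once = trans (sym (+-identityʳ _)) once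
  ... | suc zero | _      | suc _ | _ | once = cong suc (trans (sym (+-identityʳ _)) once)
  ... | suc (suc _) | s≤s () | _ | _ | _
  size : ∑ (λ v → marks D v * 1) (allFin m) ≡ m
  size = trans (∑-cong (λ v → trans (*-identityʳ _) (marks-one v)) (allFin m)) (trans (∑-1 (allFin m)) (length-tabulate id))
  indicator : ∀ u v → ∑ (uses u v) P.paths ≡ ⟦ (G □ H) u v ⟧
  indicator u v = subst₂ (λ u v → ∑ (uses u v) P.paths ≡ ⟦ (G □ H) u v ⟧) (combine-remQuot {m} n u) (combine-remQuot {m} n v)
    (at-pairs (proj₁ (remQuot {m} n u)) (proj₂ (remQuot {m} n u)) (proj₁ (remQuot {m} n v)) (proj₂ (remQuot {m} n v)))
    where
    at-pairs : ∀ a b c d → ∑ (uses (combine a b) (combine c d)) P.paths ≡ ⟦ (G □ H) (combine a b) (combine c d) ⟧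
    at-pairs a b c d = trans (P.usage a b c d) (trans (cong₂ (λ x y → δ b d * x + ⟦ H b d ⟧ * y) (usage a c)
      (trans (∑-cong (λ v → trans (cong (_* (δ a v * δ c v)) (marks-one v)) (+-identityʳ _)) (allFin m))
        (trans (∑δ a (δ c)) (δ-sym c a)))) (sym (□-indicator {H = H} sG a b c d)))
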